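{- Assume the following Conjecture holds: for every positive integer $n$ and every system $T\subseteq\{x_i+1=x_k,\ x_i\cdot x_j=x_k:\ i,j,k\in\{1,\ldots,n\}\}$ which has only finitely many solutions in positive integers $x_1,\ldots,x_n$, each such solution satisfies $x_1,\ldots,x_n\leqslant f(n)$. Then there is an algorithm which, given any polynomial $D(x_1,\ldots,x_p)$ with integer coefficients such that the equation $D(x_1,\ldots,x_p)=0$ has only finitely many rational solutions, computes an integer that bounds from above the heights of all entries of all these rational solutions.
   Context: Define $f:\mathbb{N}\setminus\{0\}\to\mathbb{N}\setminus\{0\}$ by $f(1)=1$, $f(n)=2^{2^{n-2}}$ for $n\in\{2,3,4,5\}$, and $f(n)=\left(2+2^{2^{n-4}}\right)^{2^{n-4}}$ for $n\geqslant 6$. The height of a rational number $p/q$ written in lowest terms is $\max(|p|,|q|)$. -}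

module Defs where

open import Data.Nat as ℕ using (ℕ; zero; suc; _∸_; _⊔_)
import Data.Nat
open import Data.Integer as ℤ using (ℤ; +_; ∣_∣)
open import Data.Rational as ℚ using (ℚ; 0ℚ; 1ℚ; ↥_; _/_)
open import Data.Fin using (Fin)
open import Data.Vec using (Vec; lookup)
open import Data.List using (List; []; _∷_)
open import Data.List.Membership.Propositional using (_∈_)
open import Data.List.Relation.Unary.All using (All)
open import Data.Product using (Σ; _×_)
open import Relation.Binary.PropositionalEquality using (_≡_)

f : ℕ → ℕ
f 0 = 1   -- junk value, never used (domain is positive integers)
f 1 = 1
f 2 = 2 Data.Nat.^ (2 Data.Nat.^ 0)
f 3 = 2 Data.Nat.^ (2 Data.Nat.^ 1)
f 4 = 2 Data.Nat.^ (2 Data.Nat.^ 2)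
f 5 = 2 Data.Nat.^ (2 Data.Nat.^ 3)
f n@(suc (suc (suc (suc (suc (suc _)))))) =
  (2 ℕ.+ 2 Data.Nat.^ (2 Data.Nat.^ (n ∸ 4))) Data.Nat.^ (2 Data.Nat.^ (n ∸ 4))

data Eqn (n : ℕ) : Set where
  addOne : (i k : Fin n) → Eqn n
  mul    : (i j k : Fin n) → Eqn n

Holds : ∀ {n} → Vec ℕ n → Eqn n → Set
Holds x (addOne i k) = suc (lookup x i) ≡ lookup x k
Holds x (mul i j k)  = lookup x i ℕ.* lookup x j ≡ lookup x k

System : ℕ → Set
System n = List (Eqn n)

PosSolution : ∀ {n} → System n → Vec ℕ n → Set
PosSolution {n} T x = All (λ v → 1 ℕ.≤ v) (Data.Vec.toList x) × All (Holds x) T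

Finite : {A : Set} → (A → Set) → Set
Finite {A} P = Σ (List A) (λ l → ∀ a → P a → a ∈ l)

Conjecture : Set
Conjecture = (n : ℕ) → 1 ℕ.≤ n → (T : System n) →
  Finite (PosSolution T) →
  ∀ x → PosSolution T x → All (λ v → v ℕ.≤ f n) (Data.Vec.toList x)

-- Polynomials in p variables with integer coefficients, as lists of
-- monomials (coefficient, exponent vector)

Poly : ℕ → Set
Poly p = List (ℤ × Vec ℕ p)

infixr 8 _^ℚ_
_^ℚ_ : ℚ → ℕ → ℚ
q ^ℚ zero  = 1ℚ
q ^ℚ suc e = q ℚ.* (q ^ℚ e)

monoVal : ∀ {p} → Vec ℚ p → Vec ℕ p → ℚ
monoVal Vec.[] Vec.[] = 1ℚ
  where import Data.Vec as Vec
monoVal (q Data.Vec.∷ qs) (e Data.Vec.∷ es) = (q ^ℚ e) ℚ.* monoVal qs es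

eval : ∀ {p} → Poly p → Vec ℚ p → ℚ
eval [] x = 0ℚ
eval ((c Data.Product., e) ∷ D) x = ((c / 1) ℚ.* monoVal x e) ℚ.+ eval D x

RatSolution : ∀ {p} → Poly p → Vec ℚ p → Set
RatSolution D x = eval D x ≡ 0ℚ

height : ℚ → ℕ
height q = ∣ ↥ q ∣ ⊔ ℚ.denominatorℕ q

-- Clearing denominators, a rational point x is a solution of D iff the homogenisation of D vanishes
-- at the numerators and denominators of the xᵢ. A rational is coded by seven positive integers
-- P, Q, C, U, V, W, W′ subject to four equations: P - Q is its numerator, C its denominator,
-- C U = ∣P - Q∣ (V - 1) + 1 certifies that they are coprime, and W, W′ bound U and V, so that every
-- entry of a code is bounded in terms of the height of the rational it codes. Writing integers as
-- differences of naturals and merging equations by sums of squares, D(x) = 0 together with the code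
-- equations becomes a single equation between expressions built from 1, + and ×. Compiling it into
-- gates xᵢ + 1 = xₖ and xᵢ · xⱼ = xₖ gives a system T whose positive solutions are determined by
-- their input variables and correspond to the rational solutions of D. So if D has finitely many
-- rational solutions, so has T, the Conjecture bounds all solutions of T by f(n) for the number n
-- of variables of T, and f(n) bounds the heights; n depends on D alone.

module Submission where

open import Data.Nat as ℕ using (ℕ; zero; suc; _+_; _*_; _∸_; _≤_; _<_; _<?_; z≤n; s≤s; NonZero; _/_; _%_; ∣_-_∣; pred)
import Data.Nat.Properties as ℕ
open import Data.Nat.DivMod using (m≡m%n+[m/n]*n; m%n<n)
open import Data.Nat.Coprimality using (Coprime; coprime-Bézout; Bézout-coprime; 0-coprimeTo-m⇒m≡1; recompute)
open import Data.Nat.GCD using (module Bézout)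
open import Data.Nat.Tactic.RingSolver using (solve-∀)
open import Data.Integer as ℤ using (ℤ; +_; -[1+_]; _⊖_; ∣_∣; 0ℤ)
import Data.Integer.Properties as ℤ
open import Data.Integer.Tactic.RingSolver using () renaming (solve-∀ to solveℤ-∀)
open import Data.Rational as ℚ using (ℚ; mkℚ; 0ℚ; ↥_; ↧_)
import Data.Rational.Properties as ℚ
open import Data.Rational.Solver using (module +-*-Solver)
open import Data.Rational.Unnormalised as ℚᵘ using (mkℚᵘ; *≡*)
import Data.Rational.Unnormalised.Properties as ℚᵘ
open import Data.Fin as Fin using (Fin; toℕ; fromℕ<; combine; remQuot)
import Data.Fin.Properties as Fin
open import Data.Fin.Patterns
open import Data.Vec as Vec using (Vec; []; _∷_; lookup; tabulate; toList; sum)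
import Data.Vec.Properties as Vec
import Data.Vec.Relation.Unary.All.Properties as AllVec
open import Data.Vec.Membership.Propositional.Properties using (∈-lookup; ∈-toList⁺)
open import Data.List using (List; []; _∷_; _++_; map; concat; allFin; upTo; cartesianProductWith)
open import Data.List.Relation.Unary.All as All using (All; []; _∷_)
open import Data.List.Relation.Unary.All.Properties using (++⁺; ++⁻ˡ; ++⁻ʳ; map⁺; map⁻; concat⁺; concat⁻; tabulate⁺; tabulate⁻)
open import Data.List.Relation.Unary.Any using (here)
open import Data.List.Membership.Propositional using (_∈_)
open import Data.List.Membership.Propositional.Properties using (∈-map⁺; ∈-upTo⁺; ∈-cartesianProductWith⁺)
open import Data.List.Extrema.Nat using (max; xs≤max)
open import Data.Product using (Σ; ∃₂; _×_; _,_; proj₁; proj₂; uncurry)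
open import Data.Sum using (_⊎_; inj₁; inj₂)
open import Function using (_∘_)
open import Relation.Binary.PropositionalEquality
open import Relation.Nullary using (¬_; yes; no; contradiction)

open import Defs

-- Clearing denominators

fromℤ : ℤ → ℚ
fromℤ c = c ℚ./ 1

toℚᵘ-fromℤ : ∀ c → ℚ.toℚᵘ (fromℤ c) ℚᵘ.≃ mkℚᵘ c 0
toℚᵘ-fromℤ c = ℚ.toℚᵘ-fromℚᵘ (mkℚᵘ c 0)

fromℤ-* : ∀ a b → fromℤ (a ℤ.* b) ≡ fromℤ a ℚ.* fromℤ b
fromℤ-* a b = ℚ.toℚᵘ-injective (begin
  ℚ.toℚᵘ (fromℤ (a ℤ.* b))                ≈⟨ toℚᵘ-fromℤ (a ℤ.* b) ⟩
  mkℚᵘ (a ℤ.* b) 0                        ≈⟨ *≡* (cross a b) ⟩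
  mkℚᵘ a 0 ℚᵘ.* mkℚᵘ b 0                  ≈⟨ ℚᵘ.*-cong (toℚᵘ-fromℤ a) (toℚᵘ-fromℤ b) ⟨
  ℚ.toℚᵘ (fromℤ a) ℚᵘ.* ℚ.toℚᵘ (fromℤ b)  ≈⟨ ℚ.toℚᵘ-homo-* (fromℤ a) (fromℤ b) ⟨
  ℚ.toℚᵘ (fromℤ a ℚ.* fromℤ b)            ∎)
  where
  open ℚᵘ.≃-Reasoning
  cross : ∀ a b → (a ℤ.* b) ℤ.* (+ 1 ℤ.* + 1) ≡ (a ℤ.* b) ℤ.* + 1
  cross = solveℤ-∀

fromℤ-+ : ∀ a b → fromℤ (a ℤ.+ b) ≡ fromℤ a ℚ.+ fromℤ b
fromℤ-+ a b = ℚ.toℚᵘ-injective (begin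
  ℚ.toℚᵘ (fromℤ (a ℤ.+ b))                ≈⟨ toℚᵘ-fromℤ (a ℤ.+ b) ⟩
  mkℚᵘ (a ℤ.+ b) 0                        ≈⟨ *≡* (cross a b) ⟩
  mkℚᵘ a 0 ℚᵘ.+ mkℚᵘ b 0                  ≈⟨ ℚᵘ.+-cong (toℚᵘ-fromℤ a) (toℚᵘ-fromℤ b) ⟨
  ℚ.toℚᵘ (fromℤ a) ℚᵘ.+ ℚ.toℚᵘ (fromℤ b)  ≈⟨ ℚ.toℚᵘ-homo-+ (fromℤ a) (fromℤ b) ⟨
  ℚ.toℚᵘ (fromℤ a ℚ.+ fromℤ b)            ∎)
  where
  open ℚᵘ.≃-Reasoning
  cross : ∀ a b → (a ℤ.+ b) ℤ.* (+ 1 ℤ.* + 1) ≡ (a ℤ.* + 1 ℤ.+ b ℤ.* + 1) ℤ.* + 1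
  cross = solveℤ-∀

fromℤ-^ : ∀ c e → fromℤ (c ℤ.^ e) ≡ fromℤ c ^ℚ e
fromℤ-^ c zero    = refl
fromℤ-^ c (suc e) = trans (fromℤ-* c (c ℤ.^ e)) (cong (fromℤ c ℚ.*_) (fromℤ-^ c e))

fromℤ≡0⇒≡0 : ∀ a → fromℤ a ≡ 0ℚ → a ≡ 0ℤ
fromℤ≡0⇒≡0 a eq with ℚᵘ.≃-trans (ℚᵘ.≃-sym (toℚᵘ-fromℤ a)) (ℚᵘ.≃-reflexive (cong ℚ.toℚᵘ eq))
... | *≡* a*1≡0 = trans (sym (ℤ.*-identityʳ a)) a*1≡0

*fromℤ≡0⇒≡0 : ∀ q s → ¬ s ≡ 0ℤ → q ℚ.* fromℤ s ≡ 0ℚ → q ≡ 0ℚ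
*fromℤ≡0⇒≡0 q@(mkℚ n _ _) s s≢0 eq
  with ℚᵘ.≃-trans (ℚᵘ.≃-sym (ℚᵘ.*-congˡ {ℚ.toℚᵘ q} (toℚᵘ-fromℤ s)))
         (ℚᵘ.≃-trans (ℚᵘ.≃-sym (ℚ.toℚᵘ-homo-* q (fromℤ s))) (ℚᵘ.≃-reflexive (cong ℚ.toℚᵘ eq)))
... | *≡* ns*1≡0 with ℤ.i*j≡0⇒i≡0∨j≡0 n (trans (sym (ℤ.*-identityʳ _)) ns*1≡0)
...   | inj₁ n≡0 = ℚ.↥p≡0⇒p≡0 q n≡0
...   | inj₂ s≡0 = contradiction s≡0 s≢0

*↧≡↥ : ∀ q → q ℚ.* fromℤ (↧ q) ≡ fromℤ (↥ q)
*↧≡↥ q@(mkℚ n d _) = ℚ.toℚᵘ-injective (begin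
  ℚ.toℚᵘ (q ℚ.* fromℤ (↧ q))            ≈⟨ ℚ.toℚᵘ-homo-* q (fromℤ (↧ q)) ⟩
  ℚ.toℚᵘ q ℚᵘ.* ℚ.toℚᵘ (fromℤ (↧ q))    ≈⟨ ℚᵘ.*-congˡ {ℚ.toℚᵘ q} (toℚᵘ-fromℤ (↧ q)) ⟩
  ℚ.toℚᵘ q ℚᵘ.* mkℚᵘ (↧ q) 0            ≈⟨ *≡* (cancel n (↧ q)) ⟩
  mkℚᵘ n 0                              ≈⟨ toℚᵘ-fromℤ n ⟨
  ℚ.toℚᵘ (fromℤ n)                      ∎)
  where
  open ℚᵘ.≃-Reasoning
  cancel : ∀ n d → (n ℤ.* d) ℤ.* + 1 ≡ n ℤ.* (d ℤ.* + 1)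
  cancel = solveℤ-∀

^ℚ-distribˡ-+-* : ∀ q a b → q ^ℚ (a + b) ≡ q ^ℚ a ℚ.* q ^ℚ b
^ℚ-distribˡ-+-* q zero    b = sym (ℚ.*-identityˡ _)
^ℚ-distribˡ-+-* q (suc a) b =
  trans (cong (q ℚ.*_) (^ℚ-distribˡ-+-* q a b)) (sym (ℚ.*-assoc q _ _))

^ℚ-distribʳ-* : ∀ q r a → (q ℚ.* r) ^ℚ a ≡ q ^ℚ a ℚ.* r ^ℚ a
^ℚ-distribʳ-* q r zero    = refl
^ℚ-distribʳ-* q r (suc a) rewrite ^ℚ-distribʳ-* q r a =
  solve 4 (λ q r x y → (q :* r) :* (x :* y) := (q :* x) :* (r :* y)) refl q r (q ^ℚ a) (r ^ℚ a)
  where open +-*-Solver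

module _ (E : ℕ) where

  homMonomial : ∀ {k} → (Fin k → ℤ) → (Fin k → ℤ) → Vec ℕ k → ℤ
  homMonomial n d []       = + 1
  homMonomial n d (e ∷ es) =
    (n 0F ℤ.^ e ℤ.* d 0F ℤ.^ (E ∸ e)) ℤ.* homMonomial (n ∘ Fin.suc) (d ∘ Fin.suc) es

  -- Π dᵢ ^ E · D (n₁ / d₁, …, nₚ / dₚ), a polynomial in the nᵢ and dᵢ once E bounds the degree of D.
  homogenise : ∀ {p} → Poly p → (Fin p → ℤ) → (Fin p → ℤ) → ℤ
  homogenise []            n d = + 0
  homogenise ((c , e) ∷ D) n d = c ℤ.* homMonomial n d e ℤ.+ homogenise D n d

  homMonomial-cong : ∀ {k} {n n′ d d′ : Fin k → ℤ} → (∀ i → n i ≡ n′ i) → (∀ i → d i ≡ d′ i) →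
    ∀ e → homMonomial n d e ≡ homMonomial n′ d′ e
  homMonomial-cong n≗n′ d≗d′ []       = refl
  homMonomial-cong n≗n′ d≗d′ (e ∷ es) =
    cong₂ ℤ._*_ (cong₂ (λ s t → s ℤ.^ e ℤ.* t ℤ.^ (E ∸ e)) (n≗n′ 0F) (d≗d′ 0F))
      (homMonomial-cong (n≗n′ ∘ Fin.suc) (d≗d′ ∘ Fin.suc) es)

  homogenise-cong : ∀ {p} (D : Poly p) {n n′ d d′ : Fin p → ℤ} → (∀ i → n i ≡ n′ i) → (∀ i → d i ≡ d′ i) →
    homogenise D n d ≡ homogenise D n′ d′
  homogenise-cong []            n≗n′ d≗d′ = refl
  homogenise-cong ((c , e) ∷ D) n≗n′ d≗d′ =
    cong₂ (λ s t → c ℤ.* s ℤ.+ t) (homMonomial-cong n≗n′ d≗d′ e) (homogenise-cong D n≗n′ d≗d′)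

degreeBound : ∀ {p} → Poly p → ℕ
degreeBound []            = 0
degreeBound ((_ , e) ∷ D) = sum e + degreeBound D

module _ (E : ℕ) where

  denominatorPower : ∀ {k} → Vec ℚ k → ℤ
  denominatorPower []      = + 1
  denominatorPower (q ∷ x) = ↧ q ℤ.^ E ℤ.* denominatorPower x

  denominatorPower≢0 : ∀ {k} (x : Vec ℚ k) → ¬ denominatorPower x ≡ 0ℤ
  denominatorPower≢0 (mkℚ _ _ _ ∷ x) eq with ℤ.i*j≡0⇒i≡0∨j≡0 _ eq
  ... | inj₁ d^E≡0 with () ← ℤ.i^n≡0⇒i≡0 _ E d^E≡0
  ... | inj₂ rest≡0 = denominatorPower≢0 x rest≡0

  monoVal-cleared : ∀ {k} (x : Vec ℚ k) e → sum e ≤ E →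
    monoVal x e ℚ.* fromℤ (denominatorPower x) ≡
    fromℤ (homMonomial E (↥_ ∘ lookup x) (↧_ ∘ lookup x) e)
  monoVal-cleared []      []       _ = refl
  monoVal-cleared (q ∷ x) (e ∷ es) e+es≤E = begin
    (q ^ℚ e ℚ.* M) ℚ.* fromℤ (↧ q ℤ.^ E ℤ.* denominatorPower x)
      ≡⟨ cong ((q ^ℚ e ℚ.* M) ℚ.*_)
           (trans (fromℤ-* (↧ q ℤ.^ E) (denominatorPower x)) (cong (ℚ._* S) (fromℤ-^ (↧ q) E))) ⟩
    (q ^ℚ e ℚ.* M) ℚ.* (d ^ℚ E ℚ.* S)
      ≡⟨ cong (λ t → (q ^ℚ e ℚ.* M) ℚ.* (t ℚ.* S)) d^E-split ⟩
    (q ^ℚ e ℚ.* M) ℚ.* ((d ^ℚ e ℚ.* d ^ℚ (E ∸ e)) ℚ.* S)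
      ≡⟨ solve 5 (λ a b c d s → (a :* b) :* ((c :* d) :* s) := ((a :* c) :* d) :* (b :* s))
           refl (q ^ℚ e) M (d ^ℚ e) (d ^ℚ (E ∸ e)) S ⟩
    ((q ^ℚ e ℚ.* d ^ℚ e) ℚ.* d ^ℚ (E ∸ e)) ℚ.* (M ℚ.* S)
      ≡⟨ cong₂ (λ s t → (s ℚ.* d ^ℚ (E ∸ e)) ℚ.* t)
           (trans (sym (^ℚ-distribʳ-* q d e)) (cong (_^ℚ e) (*↧≡↥ q)))
           (monoVal-cleared x es (ℕ.≤-trans (ℕ.m≤n+m (sum es) e) e+es≤E)) ⟩
    (fromℤ (↥ q) ^ℚ e ℚ.* d ^ℚ (E ∸ e)) ℚ.* fromℤ rest
      ≡⟨ cong₂ (λ s t → (s ℚ.* t) ℚ.* fromℤ rest) (sym (fromℤ-^ _ e)) (sym (fromℤ-^ _ (E ∸ e))) ⟩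
    (fromℤ (↥ q ℤ.^ e) ℚ.* fromℤ (↧ q ℤ.^ (E ∸ e))) ℚ.* fromℤ rest
      ≡⟨ cong (ℚ._* fromℤ rest) (sym (fromℤ-* (↥ q ℤ.^ e) (↧ q ℤ.^ (E ∸ e)))) ⟩
    fromℤ (↥ q ℤ.^ e ℤ.* ↧ q ℤ.^ (E ∸ e)) ℚ.* fromℤ rest
      ≡⟨ sym (fromℤ-* (↥ q ℤ.^ e ℤ.* ↧ q ℤ.^ (E ∸ e)) rest) ⟩
    fromℤ ((↥ q ℤ.^ e ℤ.* ↧ q ℤ.^ (E ∸ e)) ℤ.* rest) ∎
    where
    open ≡-Reasoning
    open +-*-Solver
    M = monoVal x es
    S = fromℤ (denominatorPower x)
    d = fromℤ (↧ q)
    rest = homMonomial E (↥_ ∘ lookup x) (↧_ ∘ lookup x) es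
    d^E-split : d ^ℚ E ≡ d ^ℚ e ℚ.* d ^ℚ (E ∸ e)
    d^E-split = trans (cong (d ^ℚ_) (sym (ℕ.m+[n∸m]≡n (ℕ.≤-trans (ℕ.m≤m+n e (sum es)) e+es≤E))))
                      (^ℚ-distribˡ-+-* d e (E ∸ e))

  eval-cleared : ∀ {p} (D : Poly p) (x : Vec ℚ p) → degreeBound D ≤ E →
    eval D x ℚ.* fromℤ (denominatorPower x) ≡ fromℤ (homogenise E D (↥_ ∘ lookup x) (↧_ ∘ lookup x))
  eval-cleared []            x _     = ℚ.*-zeroˡ (fromℤ (denominatorPower x))
  eval-cleared ((c , e) ∷ D) x deg≤E = begin
    (fromℤ c ℚ.* monoVal x e ℚ.+ eval D x) ℚ.* S
      ≡⟨ solve 4 (λ c m v s → (c :* m :+ v) :* s := c :* (m :* s) :+ v :* s) refl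
           (fromℤ c) (monoVal x e) (eval D x) S ⟩
    fromℤ c ℚ.* (monoVal x e ℚ.* S) ℚ.+ eval D x ℚ.* S
      ≡⟨ cong₂ (λ a b → fromℤ c ℚ.* a ℚ.+ b)
           (monoVal-cleared x e (ℕ.≤-trans (ℕ.m≤m+n (sum e) _) deg≤E))
           (eval-cleared D x (ℕ.≤-trans (ℕ.m≤n+m _ (sum e)) deg≤E)) ⟩
    fromℤ c ℚ.* fromℤ (homMonomial E n d e) ℚ.+ fromℤ (homogenise E D n d)
      ≡⟨ sym (trans (fromℤ-+ (c ℤ.* homMonomial E n d e) (homogenise E D n d))
                    (cong (ℚ._+ fromℤ (homogenise E D n d)) (fromℤ-* c (homMonomial E n d e)))) ⟩
    fromℤ (homogenise E ((c , e) ∷ D) n d) ∎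
    where
    open ≡-Reasoning
    open +-*-Solver
    S = fromℤ (denominatorPower x)
    n = ↥_ ∘ lookup x
    d = ↧_ ∘ lookup x

RatSolution⇒homogenise≡0 : ∀ {p} (D : Poly p) (x : Vec ℚ p) → RatSolution D x →
  homogenise (degreeBound D) D (↥_ ∘ lookup x) (↧_ ∘ lookup x) ≡ 0ℤ
RatSolution⇒homogenise≡0 D x D[x]≡0 = fromℤ≡0⇒≡0 _ (begin
  fromℤ (homogenise E D (↥_ ∘ lookup x) (↧_ ∘ lookup x))  ≡⟨ eval-cleared E D x ℕ.≤-refl ⟨
  eval D x ℚ.* S                                         ≡⟨ cong (ℚ._* S) D[x]≡0 ⟩
  0ℚ ℚ.* S                                               ≡⟨ ℚ.*-zeroˡ S ⟩
  0ℚ                                                     ∎)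
  where
  open ≡-Reasoning
  E = degreeBound D
  S = fromℤ (denominatorPower E x)

homogenise≡0⇒RatSolution : ∀ {p} (D : Poly p) (x : Vec ℚ p) →
  homogenise (degreeBound D) D (↥_ ∘ lookup x) (↧_ ∘ lookup x) ≡ 0ℤ → RatSolution D x
homogenise≡0⇒RatSolution D x hom≡0 =
  *fromℤ≡0⇒≡0 (eval D x) _ (denominatorPower≢0 _ x)
    (trans (eval-cleared _ D x ℕ.≤-refl) (cong fromℤ hom≡0))

-- Codes of rationals

coprime⇒inverse : ∀ n C .{{_ : NonZero n}} → 1 ≤ C → Coprime n C → ∃₂ λ u v → C * u ≡ n * v + 1
coprime⇒inverse n C 1≤C n⊥C with coprime-Bézout n⊥C
... | Bézout.-+ x y 1+xn≡yC = y , x , trans (ℕ.*-comm C y) (trans (sym 1+xn≡yC) (reorder x n))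
  where
  reorder : ∀ x n → 1 + x * n ≡ n * x + 1
  reorder = solve-∀
... | Bézout.+- x y 1+yC≡xn = n * K ∸ y , C * K ∸ x , ℕ.+-cancelʳ-≡ (C * y) _ _ (trans lhs (sym rhs))
  where
  -- 1 + y C = x n gives C (n K - y) = n (C K - x) + 1, and K = y + x makes both subtractions exact.
  K = y + x
  instance _ = ℕ.>-nonZero 1≤C
  y≤nK : y ≤ n * K
  y≤nK = ℕ.≤-trans (ℕ.m≤m+n y x) (ℕ.m≤n*m K n)
  x≤CK : x ≤ C * K
  x≤CK = ℕ.≤-trans (ℕ.m≤n+m x y) (ℕ.m≤n*m K C)
  lhs : C * (n * K ∸ y) + C * y ≡ C * (n * K)
  lhs = trans (sym (ℕ.*-distribˡ-+ C _ y)) (cong (C *_) (ℕ.m∸n+n≡m y≤nK))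
  rhs : n * (C * K ∸ x) + 1 + C * y ≡ C * (n * K)
  rhs = begin
    n * (C * K ∸ x) + 1 + C * y   ≡⟨ shuffle n (C * K ∸ x) C y ⟩
    n * (C * K ∸ x) + (1 + y * C) ≡⟨ cong (λ t → n * (C * K ∸ x) + t) 1+yC≡xn ⟩
    n * (C * K ∸ x) + x * n       ≡⟨ factor n (C * K ∸ x) x ⟩
    n * (C * K ∸ x + x)           ≡⟨ cong (n *_) (ℕ.m∸n+n≡m x≤CK) ⟩
    n * (C * K)                   ≡⟨ swap n C K ⟩
    C * (n * K)                   ∎
    where
    open ≡-Reasoning
    shuffle : ∀ n w C y → n * w + 1 + C * y ≡ n * w + (1 + y * C)
    shuffle = solve-∀
    factor : ∀ n w x → n * w + x * n ≡ n * (w + x)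
    factor = solve-∀
    swap : ∀ n C K → n * (C * K) ≡ C * (n * K)
    swap = solve-∀

n*v+1≢0 : ∀ n v → n * v + 1 ≢ 0
n*v+1≢0 n v eq = ℕ.0≢1+n (trans (sym eq) (ℕ.+-comm (n * v) 1))

Inverse≤ : ℕ → ℕ → Set
Inverse≤ n C = ∃₂ λ u v → C * u ≡ n * v + 1 × 1 ≤ u × u ≤ n

inverse-reduce : ∀ n C u v .{{_ : NonZero n}} → C * u ≡ n * v + 1 → Inverse≤ n C
inverse-reduce n zero    u       v eq = contradiction (sym eq) (n*v+1≢0 n v)
inverse-reduce n (suc c) zero    v eq = contradiction (trans (sym eq) (ℕ.*-zeroʳ (suc c))) (n*v+1≢0 n v)
inverse-reduce n C@(suc _) (suc t) v eq = suc r , v ∸ C * k , reduced , s≤s z≤n , m%n<n t n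
  where
  r = t % n
  k = t / n
  split : C * suc r + n * (C * k) ≡ n * v + 1
  split = begin
    C * suc r + n * (C * k) ≡⟨ regroup C r n k ⟩
    C * suc (r + k * n)     ≡⟨ cong (λ s → C * suc s) (m≡m%n+[m/n]*n t n) ⟨
    C * suc t               ≡⟨ eq ⟩
    n * v + 1               ∎
    where
    open ≡-Reasoning
    regroup : ∀ C r n k → C * suc r + n * (C * k) ≡ C * suc (r + k * n)
    regroup = solve-∀
  Ck≤v : C * k ≤ v
  Ck≤v = ℕ.*-cancelˡ-≤ n (ℕ.+-cancelʳ-≤ 1 _ _ (begin
    n * (C * k) + 1         ≤⟨ ℕ.+-monoʳ-≤ (n * (C * k)) (ℕ.≤-trans (s≤s z≤n) (ℕ.m≤m*n C (suc r))) ⟩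
    n * (C * k) + C * suc r ≡⟨ ℕ.+-comm (n * (C * k)) _ ⟩
    C * suc r + n * (C * k) ≡⟨ split ⟩
    n * v + 1               ∎))
    where open ℕ.≤-Reasoning
  reduced : C * suc r ≡ n * (v ∸ C * k) + 1
  reduced = ℕ.+-cancelʳ-≡ (n * (C * k)) _ _ (begin
    C * suc r + n * (C * k)             ≡⟨ split ⟩
    n * v + 1                           ≡⟨ cong (λ w → n * w + 1) (ℕ.m∸n+n≡m Ck≤v) ⟨
    n * (v ∸ C * k + C * k) + 1         ≡⟨ distribute n (v ∸ C * k) (C * k) ⟩
    n * (v ∸ C * k) + 1 + n * (C * k)   ∎)
    where
    open ≡-Reasoning
    distribute : ∀ n w z → n * (w + z) + 1 ≡ n * w + 1 + n * z
    distribute = solve-∀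

coprime⇒bounded-inverse : ∀ n C → 1 ≤ C → Coprime n C →
  ∃₂ λ u v → C * u ≡ n * v + 1 × 1 ≤ u × u ≤ n + 1 × v < C * u
coprime⇒bounded-inverse zero C _ 0⊥C rewrite 0-coprimeTo-m⇒m≡1 0⊥C =
  1 , 0 , refl , s≤s z≤n , s≤s z≤n , s≤s z≤n
coprime⇒bounded-inverse n@(suc _) C 1≤C n⊥C
  with u₀ , v₀ , eq₀ ← coprime⇒inverse n C 1≤C n⊥C
  with u , v , eq , 1≤u , u≤n ← inverse-reduce n C u₀ v₀ eq₀
  = u , v , eq , 1≤u , ℕ.m≤n⇒m≤n+o 1 u≤n , v<Cu
  where
  v<Cu : v < C * u
  v<Cu = ℕ.≤-trans (ℕ.≤-reflexive (ℕ.+-comm 1 v)) (subst (v + 1 ≤_) (sym eq) (ℕ.+-monoˡ-≤ 1 (ℕ.m≤n*m v n)))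

record Code : Set where
  constructor code
  field P Q C U V W W′ : ℕ

slot : Code → Fin 7 → ℕ
slot c 0F = Code.P c
slot c 1F = Code.Q c
slot c 2F = Code.C c
slot c 3F = Code.U c
slot c 4F = Code.V c
slot c 5F = Code.W c
slot c 6F = Code.W′ c

Positive : Code → Set
Positive c = ∀ o → 1 ≤ slot c o

-- With n = ∣P ⊖ Q∣ (and P + Q = n + 2), the second equation says C U = n (V - 1) + 1.
IsCode : Code → Set
IsCode (code P Q C U V W W′) =
  (P * Q + 1 ≡ P + Q) × (C * U + (P + Q) + (V + V) ≡ (P + Q) * V + 1 + 1 + 1) ×
  (U + W ≡ P + Q) × (V + W′ ≡ C * U + 1)

record Represents (c : Code) (q : ℚ) : Set where
  field
    numerator   : ↥ q ≡ Code.P c ⊖ Code.Q c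
    denominator : ↧ q ≡ + Code.C c

codeBound : ℚ → ℕ
codeBound q = (2 + ∣ ↥ q ∣) * suc (ℚ.denominatorℕ q)

P*Q+1≡P+Q⇒P≡1∨Q≡1 : ∀ a b → suc a * suc b + 1 ≡ suc a + suc b → a ≡ 0 ⊎ b ≡ 0
P*Q+1≡P+Q⇒P≡1∨Q≡1 a b eq = ℕ.m*n≡0⇒m≡0∨n≡0 a (ℕ.+-cancelʳ-≡ (2 + a + b) _ _
  (trans (sym (expand a b)) (trans eq (collect a b))))
  where
  expand : ∀ a b → suc a * suc b + 1 ≡ a * b + (2 + a + b)
  expand = solve-∀
  collect : ∀ a b → suc a + suc b ≡ 0 + (2 + a + b)
  collect = solve-∀

P+Q≡2+∣P⊖Q∣ : ∀ P Q → 1 ≤ P → 1 ≤ Q → P * Q + 1 ≡ P + Q → P + Q ≡ 2 + ∣ P ⊖ Q ∣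
P+Q≡2+∣P⊖Q∣ (suc a) (suc b) _ _ eq with P*Q+1≡P+Q⇒P≡1∨Q≡1 a b eq
... | inj₁ refl = cong (λ m → 2 + m) (sym (ℤ.∣⊖∣-≤ (s≤s z≤n)))
... | inj₂ refl = trans (ℕ.+-comm (suc a) 1) (cong (λ z → 2 + ∣ z ∣) (sym (ℤ.⊖-≥ (s≤s z≤n))))

coprimality-equation : ∀ x n v →
  x + (2 + n) + (suc v + suc v) ≡ (2 + n) * suc v + 1 + 1 + 1 → x ≡ n * v + 1
coprimality-equation x n v eq =
  ℕ.+-cancelʳ-≡ (n + 2 * v + 4) _ _ (trans (lhs x n v) (trans eq (rhs n v)))
  where
  lhs : ∀ x n v → x + (n + 2 * v + 4) ≡ x + (2 + n) + (suc v + suc v)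
  lhs = solve-∀
  rhs : ∀ n v → (2 + n) * suc v + 1 + 1 + 1 ≡ n * v + 1 + (n + 2 * v + 4)
  rhs = solve-∀

record Decoding (c : Code) : Set where
  field
    value      : ℚ
    represents : Represents c value
    bounded    : ∀ o → slot c o ≤ codeBound value

decode : ∀ c → Positive c → IsCode c → Decoding c
decode (code _ _ zero _ _ _ _) pos _ with () ← pos 2F
decode (code _ _ _ _ zero _ _) pos _ with () ← pos 4F
decode c@(code P Q C@(suc d) U V@(suc v) W W′) pos (e₁ , e₂ , e₃ , e₄) =
  record { value = q ; represents = record { numerator = refl ; denominator = refl } ; bounded = slot≤B }
  where
  n = ∣ P ⊖ Q ∣
  B = (2 + n) * suc C
  P+Q≡2+n : P + Q ≡ 2 + n
  P+Q≡2+n = P+Q≡2+∣P⊖Q∣ P Q (pos 0F) (pos 1F) e₁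
  CU≡nv+1 : C * U ≡ n * v + 1
  CU≡nv+1 = coprimality-equation (C * U) n v
    (subst (λ s → C * U + s + (V + V) ≡ s * V + 1 + 1 + 1) P+Q≡2+n e₂)
  n⊥C : Coprime n C
  n⊥C = Bézout-coprime {d = 1} (Bézout.-+ v U (begin
    1 + v * (n * 1)  ≡⟨ cong (λ m → 1 + v * m) (ℕ.*-identityʳ n) ⟩
    1 + v * n        ≡⟨ ℕ.+-comm 1 (v * n) ⟩
    v * n + 1        ≡⟨ cong (_+ 1) (ℕ.*-comm v n) ⟩
    n * v + 1        ≡⟨ CU≡nv+1 ⟨
    C * U            ≡⟨ ℕ.*-comm C U ⟩
    U * C            ≡⟨ cong (U *_) (ℕ.*-identityʳ C) ⟨
    U * (C * 1)      ∎))
    where open ≡-Reasoning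
  q = mkℚ (P ⊖ Q) d n⊥C
  ≤2+n⇒≤B : ∀ {x} → x ≤ P + Q → x ≤ B
  ≤2+n⇒≤B x≤P+Q = ℕ.≤-trans x≤P+Q (ℕ.≤-trans (ℕ.≤-reflexive P+Q≡2+n) (ℕ.m≤m*n (2 + n) (suc C)))
  U≤2+n : U ≤ 2 + n
  U≤2+n = ℕ.≤-trans (ℕ.m≤m+n U W) (ℕ.≤-reflexive (trans e₃ P+Q≡2+n))
  ≤CU+1⇒≤B : ∀ {x} → x ≤ C * U + 1 → x ≤ B
  ≤CU+1⇒≤B x≤CU+1 = ℕ.≤-trans x≤CU+1 (begin
    C * U + 1           ≤⟨ ℕ.+-mono-≤ (ℕ.*-monoʳ-≤ C U≤2+n) (s≤s z≤n) ⟩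
    C * (2 + n) + (2 + n) ≡⟨ cong (_+ (2 + n)) (ℕ.*-comm C (2 + n)) ⟩
    (2 + n) * C + (2 + n) ≡⟨ ℕ.+-comm ((2 + n) * C) (2 + n) ⟩
    (2 + n) + (2 + n) * C ≡⟨ ℕ.*-suc (2 + n) C ⟨
    B                   ∎)
    where open ℕ.≤-Reasoning
  slot≤B : ∀ o → slot c o ≤ B
  slot≤B 0F = ≤2+n⇒≤B (ℕ.m≤m+n P Q)
  slot≤B 1F = ≤2+n⇒≤B (ℕ.m≤n+m Q P)
  slot≤B 2F = ℕ.≤-trans (ℕ.n≤1+n C) (ℕ.m≤n*m (suc C) (2 + n))
  slot≤B 3F = ≤2+n⇒≤B (ℕ.≤-trans (ℕ.m≤m+n U W) (ℕ.≤-reflexive e₃))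
  slot≤B 4F = ≤CU+1⇒≤B (ℕ.≤-trans (ℕ.m≤m+n V W′) (ℕ.≤-reflexive e₄))
  slot≤B 5F = ≤2+n⇒≤B (ℕ.≤-trans (ℕ.m≤n+m W U) (ℕ.≤-reflexive e₃))
  slot≤B 6F = ≤CU+1⇒≤B (ℕ.≤-trans (ℕ.m≤n+m W′ V) (ℕ.≤-reflexive e₄))

record NumeratorCode (z : ℤ) : Set where
  field
    P Q      : ℕ
    1≤P      : 1 ≤ P
    1≤Q      : 1 ≤ Q
    P⊖Q≡z    : P ⊖ Q ≡ z
    P*Q+1≡P+Q : P * Q + 1 ≡ P + Q
    P+Q≡2+∣z∣ : P + Q ≡ 2 + ∣ z ∣

numeratorCode : ∀ z → NumeratorCode z
numeratorCode (+ k) = record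
  { P = suc k ; Q = 1 ; 1≤P = s≤s z≤n ; 1≤Q = s≤s z≤n ; P⊖Q≡z = refl
  ; P*Q+1≡P+Q = cong (_+ 1) (ℕ.*-identityʳ (suc k)) ; P+Q≡2+∣z∣ = ℕ.+-comm (suc k) 1 }
numeratorCode -[1+ k ] = record
  { P = 1 ; Q = suc (suc k) ; 1≤P = s≤s z≤n ; 1≤Q = s≤s z≤n ; P⊖Q≡z = refl
  ; P*Q+1≡P+Q = trans (cong (_+ 1) (ℕ.*-identityˡ (suc (suc k)))) (ℕ.+-comm (suc (suc k)) 1)
  ; P+Q≡2+∣z∣ = refl }

record Encoding (q : ℚ) : Set where
  field
    codeOf     : Code
    positive   : Positive codeOf
    isCode     : IsCode codeOf
    represents : Represents codeOf q

encode : ∀ q → Encoding q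
encode q@(mkℚ z d z⊥d)
  with u , v , Cu≡nv+1 , 1≤u , u≤n+1 , v<Cu ← coprime⇒bounded-inverse ∣ z ∣ (suc d) (s≤s z≤n) (recompute z⊥d)
  = record
    { codeOf = code P Q C u (suc v) (P + Q ∸ u) (C * u ∸ v) ; positive = positive
    ; isCode = P*Q+1≡P+Q , e₂ , e₃ , e₄ ; represents = record { numerator = sym P⊖Q≡z ; denominator = refl } }
  where
  open NumeratorCode (numeratorCode z)
  C = suc d
  u<P+Q : u < P + Q
  u<P+Q = ℕ.<-≤-trans (s≤s (subst (u ≤_) (ℕ.+-comm ∣ z ∣ 1) u≤n+1)) (ℕ.≤-reflexive (sym P+Q≡2+∣z∣))
  e₂ : C * u + (P + Q) + (suc v + suc v) ≡ (P + Q) * suc v + 1 + 1 + 1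
  e₂ = subst (λ s → C * u + s + (suc v + suc v) ≡ s * suc v + 1 + 1 + 1) (sym P+Q≡2+∣z∣)
         (trans (cong (λ t → t + (2 + ∣ z ∣) + (suc v + suc v)) Cu≡nv+1) (expand ∣ z ∣ v))
    where
    expand : ∀ n v → n * v + 1 + (2 + n) + (suc v + suc v) ≡ (2 + n) * suc v + 1 + 1 + 1
    expand = solve-∀
  e₃ : u + (P + Q ∸ u) ≡ P + Q
  e₃ = ℕ.m+[n∸m]≡n (ℕ.<⇒≤ u<P+Q)
  e₄ : suc v + (C * u ∸ v) ≡ C * u + 1
  e₄ = trans (cong suc (ℕ.m+[n∸m]≡n (ℕ.<⇒≤ v<Cu))) (ℕ.+-comm 1 (C * u))
  positive : ∀ o → 1 ≤ slot (code P Q C u (suc v) (P + Q ∸ u) (C * u ∸ v)) o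
  positive 0F = 1≤P
  positive 1F = 1≤Q
  positive 2F = s≤s z≤n
  positive 3F = 1≤u
  positive 4F = s≤s z≤n
  positive 5F = ℕ.m<n⇒0<n∸m u<P+Q
  positive 6F = ℕ.m<n⇒0<n∸m v<Cu

height≤ : ∀ {c q F} → Represents c q → Code.P c ≤ F → Code.Q c ≤ F → Code.C c ≤ F → height q ≤ F
height≤ {c} rep P≤F Q≤F C≤F = ℕ.⊔-lub
  (subst (_≤ _) (cong ∣_∣ (sym (Represents.numerator rep)))
    (ℕ.≤-trans (ℤ.∣m⊝n∣≤m⊔n (Code.P c) (Code.Q c)) (ℕ.⊔-lub P≤F Q≤F)))
  (subst (_≤ _) (cong ∣_∣ (sym (Represents.denominator rep))) C≤F)

-- Circuits of +1 and × gates

Env : Set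
Env = ℕ → ℕ

PositiveEnv : Env → Set
PositiveEnv ρ = ∀ j → 1 ≤ ρ j

data Gate : Set where
  plus1 : ℕ → ℕ → Gate
  times : ℕ → ℕ → ℕ → Gate

infix 4 _⊨_
_⊨_ : Env → Gate → Set
ρ ⊨ plus1 i k   = suc (ρ i) ≡ ρ k
ρ ⊨ times i j k = ρ i * ρ j ≡ ρ k

data Position (q w j : ℕ) : Set where
  before : j < q → Position q w j
  inside : (o : Fin w) → j ≡ q + toℕ o → Position q w j
  after  : q + w ≤ j → Position q w j

position : ∀ q w j → Position q w j
position q w j with j <? q
... | yes j<q = before j<q
... | no j≮q with j ∸ q <? w
...   | yes j∸q<w = inside (fromℕ< j∸q<w)
          (trans (sym (ℕ.m+[n∸m]≡n (ℕ.≮⇒≥ j≮q))) (cong (λ o → q + o) (sym (Fin.toℕ-fromℕ< j∸q<w))))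
...   | no j∸q≮w = after (subst (q + w ≤_) (ℕ.m+[n∸m]≡n (ℕ.≮⇒≥ j≮q)) (ℕ.+-monoʳ-≤ q (ℕ.≮⇒≥ j∸q≮w)))

override : ∀ {w} → Env → ℕ → (Fin w → ℕ) → Env
override {w} ρ q f j with position q w j
... | inside o _ = f o
... | before _   = ρ j
... | after _    = ρ j

override-before : ∀ {w} ρ q (f : Fin w → ℕ) {j} → j < q → override ρ q f j ≡ ρ j
override-before {w} ρ q f {j} j<q with position q w j
... | before _   = refl
... | after _    = refl
... | inside o refl = contradiction j<q (ℕ.m+n≮m q (toℕ o))

override-inside : ∀ {w} ρ q (f : Fin w → ℕ) o → override ρ q f (q + toℕ o) ≡ f o
override-inside {w} ρ q f o with position q w (q + toℕ o)
... | inside o′ eq = cong f (Fin.toℕ-injective (sym (ℕ.+-cancelˡ-≡ q _ _ eq)))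
... | before q+o<q = contradiction q+o<q (ℕ.m+n≮m q (toℕ o))
... | after q+w≤q+o = contradiction (ℕ.+-cancelˡ-≤ q _ _ q+w≤q+o) (ℕ.<⇒≱ (Fin.toℕ<n o))

override-positive : ∀ {w} ρ q (f : Fin w → ℕ) → PositiveEnv ρ → (∀ o → 1 ≤ f o) → PositiveEnv (override ρ q f)
override-positive {w} ρ q f ρ-pos f-pos j with position q w j
... | inside o _ = f-pos o
... | before _   = ρ-pos j
... | after _    = ρ-pos j

-- A gadget placed at q computes op of its input variables x, y using the fresh variables
-- q, …, q + span - 1.
record Gadget : Set where
  field
    op              : ℕ → ℕ → ℕ
    span            : ℕ
    output          : Fin span
    gates           : (x y q : ℕ) → List Gate
    values          : ℕ → ℕ → Fin span → ℕ
    values-output   : ∀ X Y → values X Y output ≡ op X Y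
    values-positive : ∀ X Y → 1 ≤ X → 1 ≤ Y → ∀ o → 1 ≤ values X Y o
    satisfied       : ∀ ρ x y q → (∀ o → ρ (q + toℕ o) ≡ values (ρ x) (ρ y) o) → All (ρ ⊨_) (gates x y q)
    forced          : ∀ ρ x y q → PositiveEnv ρ → All (ρ ⊨_) (gates x y q) →
                      ∀ o → ρ (q + toℕ o) ≡ values (ρ x) (ρ y) o

-- Fresh variables are addressed as q + toℕ o, so the output variable is written q + 0.
mulGadget : Gadget
mulGadget = record
  { op = _*_ ; span = 1 ; output = 0F
  ; gates = λ x y q → times x y (q + 0) ∷ []
  ; values = λ X Y _ → X * Y
  ; values-output = λ _ _ → refl
  ; values-positive = λ _ _ 1≤X 1≤Y _ → ℕ.*-mono-≤ 1≤X 1≤Y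
  ; satisfied = λ ρ x y q h → sym (h 0F) ∷ []
  ; forced = λ { ρ x y q _ (g ∷ []) 0F → sym g }
  }

Z≡X+Y : ∀ X Y Z → 1 ≤ Z → suc (Z * Z * suc (X * Y)) ≡ suc (X * Z) * suc (Y * Z) → Z ≡ X + Y
Z≡X+Y X Y Z@(suc _) _ eq = ℕ.*-cancelˡ-≡ Z (X + Y) Z
  (ℕ.+-cancelʳ-≡ (X * Y * Z * Z) (Z * Z) (Z * (X + Y))
    (ℕ.suc-injective (trans (sym (lhs X Y Z)) (trans eq (rhs X Y Z)))))
  where
  lhs : ∀ X Y Z → suc (Z * Z * suc (X * Y)) ≡ suc (Z * Z + X * Y * Z * Z)
  lhs = solve-∀
  rhs : ∀ X Y Z → suc (X * Z) * suc (Y * Z) ≡ suc (Z * (X + Y) + X * Y * Z * Z)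
  rhs = solve-∀

-- The output Z is forced to be X + Y by the identity (Z² (XY + 1) + 1 = (XZ + 1)(YZ + 1)),
-- which for Z ≥ 1 holds exactly when Z = X + Y.
addGadget : Gadget
addGadget = record
  { op = _+_ ; span = 10 ; output = 0F ; gates = gates ; values = values
  ; values-output = λ _ _ → refl ; values-positive = positive ; satisfied = satisfied ; forced = forced }
  where
  gates : ℕ → ℕ → ℕ → List Gate
  gates x y q =
    times x (q + 0) (q + 1) ∷ plus1 (q + 1) (q + 2) ∷ times y (q + 0) (q + 3) ∷ plus1 (q + 3) (q + 4) ∷
    times (q + 2) (q + 4) (q + 5) ∷ times (q + 0) (q + 0) (q + 6) ∷ times x y (q + 7) ∷ plus1 (q + 7) (q + 8) ∷
    times (q + 6) (q + 8) (q + 9) ∷ plus1 (q + 9) (q + 5) ∷ []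

  values : ℕ → ℕ → Fin 10 → ℕ
  values X Y 0F = X + Y
  values X Y 1F = X * (X + Y)
  values X Y 2F = suc (X * (X + Y))
  values X Y 3F = Y * (X + Y)
  values X Y 4F = suc (Y * (X + Y))
  values X Y 5F = suc (X * (X + Y)) * suc (Y * (X + Y))
  values X Y 6F = (X + Y) * (X + Y)
  values X Y 7F = X * Y
  values X Y 8F = suc (X * Y)
  values X Y 9F = (X + Y) * (X + Y) * suc (X * Y)

  positive : ∀ X Y → 1 ≤ X → 1 ≤ Y → ∀ o → 1 ≤ values X Y o
  positive X Y 1≤X 1≤Y = λ
    { 0F → 1≤X+Y ; 1F → ℕ.*-mono-≤ 1≤X 1≤X+Y ; 2F → s≤s z≤n ; 3F → ℕ.*-mono-≤ 1≤Y 1≤X+Y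
    ; 4F → s≤s z≤n ; 5F → s≤s z≤n
    ; 6F → ℕ.*-mono-≤ 1≤X+Y 1≤X+Y ; 7F → ℕ.*-mono-≤ 1≤X 1≤Y ; 8F → s≤s z≤n
    ; 9F → ℕ.*-mono-≤ (ℕ.*-mono-≤ 1≤X+Y 1≤X+Y) (s≤s (z≤n {X * Y})) }
    where
    1≤X+Y = ℕ.≤-trans 1≤X (ℕ.m≤m+n X Y)

  identity : ∀ X Y → suc ((X + Y) * (X + Y) * suc (X * Y)) ≡ suc (X * (X + Y)) * suc (Y * (X + Y))
  identity = solve-∀

  satisfied : ∀ ρ x y q → (∀ o → ρ (q + toℕ o) ≡ values (ρ x) (ρ y) o) → All (ρ ⊨_) (gates x y q)
  satisfied ρ x y q h =
    step (cong (ρ x *_) (h 0F)) (h 1F) ∷ step (cong suc (h 1F)) (h 2F) ∷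
    step (cong (ρ y *_) (h 0F)) (h 3F) ∷ step (cong suc (h 3F)) (h 4F) ∷
    step (cong₂ _*_ (h 2F) (h 4F)) (h 5F) ∷ step (cong₂ _*_ (h 0F) (h 0F)) (h 6F) ∷
    sym (h 7F) ∷ step (cong suc (h 7F)) (h 8F) ∷
    step (cong₂ _*_ (h 6F) (h 8F)) (h 9F) ∷ step (trans (cong suc (h 9F)) (identity (ρ x) (ρ y))) (h 5F) ∷ []
    where
    step : ∀ {a b c} → a ≡ c → b ≡ c → a ≡ b
    step a≡c b≡c = trans a≡c (sym b≡c)

  forced : ∀ ρ x y q → PositiveEnv ρ → All (ρ ⊨_) (gates x y q) →
           ∀ o → ρ (q + toℕ o) ≡ values (ρ x) (ρ y) o
  forced ρ x y q ρ-pos (g₁ ∷ g₂ ∷ g₃ ∷ g₄ ∷ g₅ ∷ g₆ ∷ g₇ ∷ g₈ ∷ g₉ ∷ g₁₀ ∷ []) = forced-values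
    where
    X = ρ x
    Y = ρ y
    Z = ρ (q + 0)
    Z-sum : Z ≡ X + Y
    Z-sum = Z≡X+Y X Y Z (ρ-pos (q + 0)) (begin
      suc (Z * Z * suc (X * Y))              ≡⟨ cong (λ t → suc (Z * Z * suc t)) g₇ ⟩
      suc (Z * Z * suc (ρ (q + 7)))          ≡⟨ cong₂ (λ s t → suc (s * t)) g₆ g₈ ⟩
      suc (ρ (q + 6) * ρ (q + 8))            ≡⟨ cong suc g₉ ⟩
      suc (ρ (q + 9))                        ≡⟨ g₁₀ ⟩
      ρ (q + 5)                              ≡⟨ g₅ ⟨
      ρ (q + 2) * ρ (q + 4)                  ≡⟨ cong₂ _*_ g₂ g₄ ⟨
      suc (ρ (q + 1)) * suc (ρ (q + 3))      ≡⟨ cong₂ (λ s t → suc s * suc t) g₁ g₃ ⟨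
      suc (X * Z) * suc (Y * Z)              ∎)
      where open ≡-Reasoning
    x₁ : ρ (q + 1) ≡ X * (X + Y)
    x₁ = trans (sym g₁) (cong (X *_) Z-sum)
    x₃ : ρ (q + 3) ≡ Y * (X + Y)
    x₃ = trans (sym g₃) (cong (Y *_) Z-sum)
    x₆ : ρ (q + 6) ≡ (X + Y) * (X + Y)
    x₆ = trans (sym g₆) (cong₂ _*_ Z-sum Z-sum)
    x₈ : ρ (q + 8) ≡ suc (X * Y)
    x₈ = trans (sym g₈) (cong suc (sym g₇))
    forced-values : ∀ o → ρ (q + toℕ o) ≡ values X Y o
    forced-values 0F = Z-sum
    forced-values 1F = x₁
    forced-values 2F = trans (sym g₂) (cong suc x₁)
    forced-values 3F = x₃
    forced-values 4F = trans (sym g₄) (cong suc x₃)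
    forced-values 5F = trans (sym g₅) (cong₂ _*_ (trans (sym g₂) (cong suc x₁)) (trans (sym g₄) (cong suc x₃)))
    forced-values 6F = x₆
    forced-values 7F = sym g₇
    forced-values 8F = x₈
    forced-values 9F = trans (sym g₉) (cong₂ _*_ x₆ x₈)

data Expr (m : ℕ) : Set where
  var  : Fin m → Expr m
  one  : Expr m
  node : Gadget → Expr m → Expr m → Expr m

infixl 6 _⊕_
infixl 7 _⊗_

_⊕_ _⊗_ : ∀ {m} → Expr m → Expr m → Expr m
_⊕_ = node addGadget
_⊗_ = node mulGadget

⟦_⟧ : ∀ {m} → Expr m → (Fin m → ℕ) → ℕ
⟦ var i ⟧      a = a i
⟦ one ⟧        a = 1
⟦ node g e f ⟧ a = Gadget.op g (⟦ e ⟧ a) (⟦ f ⟧ a)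

⟦⟧-cong : ∀ {m} (e : Expr m) {a b} → (∀ i → a i ≡ b i) → ⟦ e ⟧ a ≡ ⟦ e ⟧ b
⟦⟧-cong (var i)      a≗b = a≗b i
⟦⟧-cong one          a≗b = refl
⟦⟧-cong (node g e f) a≗b = cong₂ (Gadget.op g) (⟦⟧-cong e a≗b) (⟦⟧-cong f a≗b)

-- Variable 0 holds the constant 1 and variables 1, …, m the inputs.
inputs : ∀ {m} → Env → Fin m → ℕ
inputs ρ i = ρ (suc (toℕ i))

record Compiled : Set where
  constructor compiled
  field
    gates  : List Gate
    output : ℕ
    next   : ℕ
open Compiled public

compile : ∀ {m} → Expr m → ℕ → Compiled
compile (var i)      pos = compiled [] (suc (toℕ i)) pos
compile one          pos = compiled [] 0 pos
compile (node g a b) pos =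
  compiled (gates A ++ gates B ++ Gadget.gates g (output A) (output B) (next B))
           (next B + toℕ (Gadget.output g)) (next B + Gadget.span g)
  where
  A = compile a pos
  B = compile b (next A)

run : ∀ {m} → Expr m → ℕ → Env → Env
run (var i)      pos ρ = ρ
run one          pos ρ = ρ
run (node g a b) pos ρ = override RB (next B) (Gadget.values g (RB (output A)) (RB (output B)))
  where
  A  = compile a pos
  B  = compile b (next A)
  RB = run b (next A) (run a pos ρ)

module Node {m : ℕ} (g : Gadget) (a b : Expr m) (pos : ℕ) (ρ : Env) where
  A  = compile a pos
  B  = compile b (next A)
  q  = next B
  RA = run a pos ρ
  RB = run b (next A) RA

module _ {m : ℕ} where

  next-mono : ∀ (e : Expr m) pos → pos ≤ next (compile e pos)
  next-mono (var i)      pos = ℕ.≤-refl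
  next-mono one          pos = ℕ.≤-refl
  next-mono (node g a b) pos = ℕ.≤-trans (ℕ.≤-trans (next-mono a pos) (next-mono b _)) (ℕ.m≤m+n _ _)

  output<next : ∀ (e : Expr m) pos → m < pos → output (compile e pos) < next (compile e pos)
  output<next (var i)      pos m<pos = ℕ.≤-<-trans (Fin.toℕ<n i) m<pos
  output<next one          pos m<pos = ℕ.≤-<-trans z≤n m<pos
  output<next (node g a b) pos m<pos = ℕ.+-monoʳ-< _ (Fin.toℕ<n (Gadget.output g))

  run-before : ∀ (e : Expr m) pos ρ {j} → j < pos → run e pos ρ j ≡ ρ j
  run-before (var i)      pos ρ j<pos = refl
  run-before one          pos ρ j<pos = refl
  run-before (node g a b) pos ρ j<pos =
    trans (override-before RB q _ (ℕ.<-≤-trans j<pos (ℕ.≤-trans (next-mono a pos) (next-mono b _))))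
      (trans (run-before b (next A) RA (ℕ.<-≤-trans j<pos (next-mono a pos))) (run-before a pos ρ j<pos))
    where open Node g a b pos ρ

  run-positive : ∀ (e : Expr m) pos ρ → PositiveEnv ρ → PositiveEnv (run e pos ρ)
  run-positive (var i)      pos ρ ρ-pos = ρ-pos
  run-positive one          pos ρ ρ-pos = ρ-pos
  run-positive (node g a b) pos ρ ρ-pos = override-positive RB q _ RB-pos
    (Gadget.values-positive g _ _ (RB-pos (output A)) (RB-pos (output B)))
    where
    open Node g a b pos ρ
    RB-pos = run-positive b (next A) RA (run-positive a pos ρ ρ-pos)

  run-satisfies : ∀ (e : Expr m) pos ρ σ → m < pos →
    (∀ j → j < next (compile e pos) → σ j ≡ run e pos ρ j) → All (σ ⊨_) (gates (compile e pos))
  run-satisfies (var i)      pos ρ σ m<pos σ≗run = []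
  run-satisfies one          pos ρ σ m<pos σ≗run = []
  run-satisfies (node g a b) pos ρ σ m<pos σ≗run =
    ++⁺ (run-satisfies a pos ρ σ m<pos σ≗RA)
      (++⁺ (run-satisfies b (next A) RA σ m<next-A σ≗RB) (Gadget.satisfied g σ (output A) (output B) q fresh))
    where
    open Node g a b pos ρ
    m<next-A = ℕ.<-≤-trans m<pos (next-mono a pos)
    σ≗RB : ∀ j → j < q → σ j ≡ RB j
    σ≗RB j j<q = trans (σ≗run j (ℕ.<-≤-trans j<q (ℕ.m≤m+n q _))) (override-before RB q _ j<q)
    σ≗RA : ∀ j → j < next A → σ j ≡ RA j
    σ≗RA j j<next-A =
      trans (σ≗RB j (ℕ.<-≤-trans j<next-A (next-mono b (next A)))) (run-before b (next A) RA j<next-A)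
    fresh : ∀ o → σ (q + toℕ o) ≡ Gadget.values g (σ (output A)) (σ (output B)) o
    fresh o = trans (σ≗run (q + toℕ o) (ℕ.+-monoʳ-< q (Fin.toℕ<n o)))
      (trans (override-inside RB q _ o)
        (cong₂ (λ X Y → Gadget.values g X Y o)
          (sym (σ≗RB (output A) (ℕ.<-≤-trans (output<next a pos m<pos) (next-mono b (next A)))))
          (sym (σ≗RB (output B) (output<next b (next A) m<next-A)))))

  run-unique : ∀ (e : Expr m) pos ρ σ → m < pos → PositiveEnv σ → (∀ j → j < pos → σ j ≡ ρ j) →
    All (σ ⊨_) (gates (compile e pos)) → ∀ j → j < next (compile e pos) → σ j ≡ run e pos ρ j
  run-unique (var i)      pos ρ σ m<pos σ-pos σ≗ρ σ⊨ = σ≗ρ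
  run-unique one          pos ρ σ m<pos σ-pos σ≗ρ σ⊨ = σ≗ρ
  run-unique (node g a b) pos ρ σ m<pos σ-pos σ≗ρ σ⊨ = agree
    where
    open Node g a b pos ρ
    m<next-A = ℕ.<-≤-trans m<pos (next-mono a pos)
    σ⊨A = ++⁻ˡ (gates A) σ⊨
    σ⊨B = ++⁻ˡ (gates B) (++⁻ʳ (gates A) σ⊨)
    σ⊨g = ++⁻ʳ (gates B) (++⁻ʳ (gates A) σ⊨)
    σ≗RA = run-unique a pos ρ σ m<pos σ-pos σ≗ρ σ⊨A
    σ≗RB = run-unique b (next A) RA σ m<next-A σ-pos σ≗RA σ⊨B
    agree : ∀ j → j < q + Gadget.span g → σ j ≡ run (node g a b) pos ρ j
    agree j j<next = agree-at (position q (Gadget.span g) j) j<next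
      where
      agree-at : ∀ {j} → Position q (Gadget.span g) j → j < q + Gadget.span g → σ j ≡ run (node g a b) pos ρ j
      agree-at (before j<q)     _      = trans (σ≗RB _ j<q) (sym (override-before RB q _ j<q))
      agree-at (after q+span≤j) j<next = contradiction j<next (ℕ.≤⇒≯ q+span≤j)
      agree-at (inside o refl)  _      = trans (Gadget.forced g σ (output A) (output B) q σ-pos σ⊨g o)
        (trans (cong₂ (λ X Y → Gadget.values g X Y o)
                 (σ≗RB (output A) (ℕ.<-≤-trans (output<next a pos m<pos) (next-mono b (next A))))
                 (σ≗RB (output B) (output<next b (next A) m<next-A)))
               (sym (override-inside RB q _ o)))

  output-value : ∀ (e : Expr m) pos σ → PositiveEnv σ → σ 0 ≡ 1 →
    All (σ ⊨_) (gates (compile e pos)) → σ (output (compile e pos)) ≡ ⟦ e ⟧ (inputs σ)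
  output-value (var i)      pos σ σ-pos σ0≡1 σ⊨ = refl
  output-value one          pos σ σ-pos σ0≡1 σ⊨ = σ0≡1
  output-value (node g a b) pos σ σ-pos σ0≡1 σ⊨ = begin
    σ (q + toℕ (Gadget.output g))                          ≡⟨ Gadget.forced g σ _ _ q σ-pos σ⊨g _ ⟩
    Gadget.values g (σ (output A)) (σ (output B)) _        ≡⟨ Gadget.values-output g _ _ ⟩
    Gadget.op g (σ (output A)) (σ (output B))              ≡⟨ cong₂ (Gadget.op g)
                                                                (output-value a pos σ σ-pos σ0≡1 σ⊨A)
                                                                (output-value b (next A) σ σ-pos σ0≡1 σ⊨B) ⟩
    Gadget.op g (⟦ a ⟧ (inputs σ)) (⟦ b ⟧ (inputs σ))      ∎
    where
    open ≡-Reasoning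
    open Node g a b pos σ
    σ⊨A = ++⁻ˡ (gates A) σ⊨
    σ⊨B = ++⁻ˡ (gates B) (++⁻ʳ (gates A) σ⊨)
    σ⊨g = ++⁻ʳ (gates B) (++⁻ʳ (gates A) σ⊨)

-- Systems of the shape of the Conjecture

squares-gap : ∀ x y → x * x + y * y ≡ x * y + x * y + ∣ x - y ∣ * ∣ x - y ∣
squares-gap zero    y       = refl
squares-gap (suc x) zero    = right-zero (suc x)
  where
  right-zero : ∀ x → x * x + 0 * 0 ≡ x * 0 + x * 0 + x * x
  right-zero = solve-∀
squares-gap (suc x) (suc y) = begin
  suc x * suc x + suc y * suc y                       ≡⟨ expand x y ⟩
  (x * x + y * y) + (2 + x + x + y + y)               ≡⟨ cong (_+ (2 + x + x + y + y)) (squares-gap x y) ⟩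
  (x * y + x * y + g * g) + (2 + x + x + y + y)       ≡⟨ collect x y (g * g) ⟩
  suc x * suc y + suc x * suc y + g * g               ∎
  where
  open ≡-Reasoning
  g = ∣ x - y ∣
  expand : ∀ x y → suc x * suc x + suc y * suc y ≡ (x * x + y * y) + (2 + x + x + y + y)
  expand = solve-∀
  collect : ∀ x y h → (x * y + x * y + h) + (2 + x + x + y + y) ≡ suc x * suc y + suc x * suc y + h
  collect = solve-∀

squares-≥ : ∀ x y → x * y + x * y ≤ x * x + y * y
squares-≥ x y = subst (x * y + x * y ≤_) (sym (squares-gap x y)) (ℕ.m≤m+n _ _)

squares-≡⇒≡ : ∀ x y → x * x + y * y ≡ x * y + x * y → x ≡ y
squares-≡⇒≡ x y eq with ℕ.m*n≡0⇒m≡0∨n≡0 ∣ x - y ∣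
  (ℕ.+-cancelˡ-≡ (x * y + x * y) _ 0 (trans (sym (squares-gap x y)) (trans eq (sym (ℕ.+-identityʳ _)))))
... | inj₁ gap≡0 = ℕ.∣m-n∣≡0⇒m≡n gap≡0
... | inj₂ gap≡0 = ℕ.∣m-n∣≡0⇒m≡n gap≡0

≤-+-≡⇒≡ : ∀ {a b c d} → c ≤ a → d ≤ b → a + b ≡ c + d → a ≡ c × b ≡ d
≤-+-≡⇒≡ {a} {b} {c} {d} c≤a d≤b eq = a≡c , ℕ.+-cancelˡ-≡ c b d (trans (cong (_+ b) (sym a≡c)) eq)
  where
  a≡c : a ≡ c
  a≡c = ℕ.≤-antisym (ℕ.+-cancelʳ-≤ b a c (ℕ.≤-trans (ℕ.≤-reflexive eq) (ℕ.+-monoʳ-≤ c d≤b))) c≤a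

Equation : ℕ → Set
Equation m = Expr m × Expr m

Satisfies : ∀ {m} → List (Equation m) → (Fin m → ℕ) → Set
Satisfies es a = All (λ e → ⟦ proj₁ e ⟧ a ≡ ⟦ proj₂ e ⟧ a) es

-- l₁ = r₁ ∧ … ∧ lₙ = rₙ  iff  1 + Σ (lᵢ² + rᵢ²) = 1 + Σ 2 lᵢ rᵢ, since each summand on the
-- left dominates the one on the right.
conjunction : ∀ {m} → List (Equation m) → Equation m
conjunction []            = one , one
conjunction ((l , r) ∷ es) =
  (l ⊗ l ⊕ r ⊗ r) ⊕ proj₁ (conjunction es) , (l ⊗ r ⊕ l ⊗ r) ⊕ proj₂ (conjunction es)

module _ {m : ℕ} (a : Fin m → ℕ) where

  conjunction-≥ : ∀ es → ⟦ proj₂ (conjunction es) ⟧ a ≤ ⟦ proj₁ (conjunction es) ⟧ a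
  conjunction-≥ []            = ℕ.≤-refl
  conjunction-≥ ((l , r) ∷ es) = ℕ.+-mono-≤ (squares-≥ (⟦ l ⟧ a) (⟦ r ⟧ a)) (conjunction-≥ es)

  conjunction-sound : ∀ es → Satisfies es a → ⟦ proj₁ (conjunction es) ⟧ a ≡ ⟦ proj₂ (conjunction es) ⟧ a
  conjunction-sound []             []       = refl
  conjunction-sound ((l , r) ∷ es) (l≡r ∷ ⊨es) rewrite l≡r =
    cong (λ t → ⟦ r ⟧ a * ⟦ r ⟧ a + ⟦ r ⟧ a * ⟦ r ⟧ a + t) (conjunction-sound es ⊨es)

  conjunction-complete : ∀ es → ⟦ proj₁ (conjunction es) ⟧ a ≡ ⟦ proj₂ (conjunction es) ⟧ a → Satisfies es a
  conjunction-complete []             _  = []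
  conjunction-complete ((l , r) ∷ es) eq
    with squares≡ , rest≡ ← ≤-+-≡⇒≡ (squares-≥ (⟦ l ⟧ a) (⟦ r ⟧ a)) (conjunction-≥ es) eq
    = squares-≡⇒≡ (⟦ l ⟧ a) (⟦ r ⟧ a) squares≡ ∷ conjunction-complete es rest≡

fromInputs : ∀ {m} → (Fin m → ℕ) → Env
fromInputs a zero = 1
fromInputs {m} a (suc j) with j <? m
... | yes j<m = a (fromℕ< j<m)
... | no  _   = 1

fromInputs-suc : ∀ {m} (a : Fin m → ℕ) {j} (j<m : j < m) → fromInputs a (suc j) ≡ a (fromℕ< j<m)
fromInputs-suc {m} a {j} j<m with j <? m
... | yes _   = refl
... | no j≮m = contradiction j<m j≮m

inputs-fromInputs : ∀ {m} (a : Fin m → ℕ) i → inputs (fromInputs a) i ≡ a i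
inputs-fromInputs a i = trans (fromInputs-suc a (Fin.toℕ<n i)) (cong a (Fin.fromℕ<-toℕ i (Fin.toℕ<n i)))

fromInputs-positive : ∀ {m} (a : Fin m → ℕ) → (∀ i → 1 ≤ a i) → PositiveEnv (fromInputs a)
fromInputs-positive a a-pos zero = s≤s z≤n
fromInputs-positive {m} a a-pos (suc j) with j <? m
... | yes j<m = a-pos (fromℕ< j<m)
... | no  _   = s≤s z≤n

fromInputs-agrees : ∀ {m} (a : Fin m → ℕ) σ → σ 0 ≡ 1 → (∀ i → a i ≡ inputs σ i) →
  ∀ j → j < suc m → σ j ≡ fromInputs a j
fromInputs-agrees a σ σ0≡1 a≗σ zero    _           = σ0≡1
fromInputs-agrees a σ σ0≡1 a≗σ (suc j) (s≤s j<m) = begin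
  σ (suc j)                   ≡⟨ cong (λ k → σ (suc k)) (Fin.toℕ-fromℕ< j<m) ⟨
  inputs σ (fromℕ< j<m)       ≡⟨ a≗σ (fromℕ< j<m) ⟨
  a (fromℕ< j<m)              ≡⟨ fromInputs-suc a j<m ⟨
  fromInputs a (suc j)        ∎
  where open ≡-Reasoning

toFin : ∀ {n} → ℕ → Fin (suc n)
toFin {n} j with j <? suc n
... | yes j<n = fromℕ< j<n
... | no  _   = Fin.zero

toFin-toℕ : ∀ {n} (k : Fin (suc n)) → toFin (toℕ k) ≡ k
toFin-toℕ {n} k with toℕ k <? suc n
... | yes k<n = Fin.fromℕ<-toℕ k k<n
... | no  k≮n = contradiction (Fin.toℕ<n k) k≮n

toℕ-toFin : ∀ {n j} → j < suc n → toℕ (toFin {n} j) ≡ j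
toℕ-toFin {n} {j} j<n with j <? suc n
... | yes _   = Fin.toℕ-fromℕ< j<n
... | no  j≮n = contradiction j<n j≮n

envOf : ∀ {n} → Vec ℕ (suc n) → Env
envOf v j = lookup v (toFin j)

toEqn : ∀ {n} → Gate → Eqn (suc n)
toEqn (plus1 i k)   = addOne (toFin i) (toFin k)
toEqn (times i j k) = mul (toFin i) (toFin j) (toFin k)

Holds⇒⊨ : ∀ {n} (v : Vec ℕ (suc n)) gs → All (Holds v) (map toEqn gs) → All (envOf v ⊨_) gs
Holds⇒⊨ v gs holds = All.map (λ {g} → at g) (map⁻ holds)
  where
  at : ∀ g → Holds v (toEqn g) → envOf v ⊨ g
  at (plus1 _ _)   h = h
  at (times _ _ _) h = h

⊨⇒Holds : ∀ {n} (v : Vec ℕ (suc n)) gs → All (envOf v ⊨_) gs → All (Holds v) (map toEqn gs)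
⊨⇒Holds v gs ⊨gs = map⁺ (All.map (λ {g} → at g) ⊨gs)
  where
  at : ∀ g → envOf v ⊨ g → Holds v (toEqn g)
  at (plus1 _ _)   h = h
  at (times _ _ _) h = h

boundedVecs : ∀ n → ℕ → List (Vec ℕ n)
boundedVecs zero    B = Vec.[] ∷ []
boundedVecs (suc n) B = cartesianProductWith Vec._∷_ (upTo (suc B)) (boundedVecs n B)

∈-boundedVecs : ∀ {n B} (w : Vec ℕ n) → (∀ i → lookup w i ≤ B) → w ∈ boundedVecs n B
∈-boundedVecs Vec.[]       w≤B = here refl
∈-boundedVecs (x Vec.∷ w) w≤B =
  ∈-cartesianProductWith⁺ Vec._∷_ (∈-upTo⁺ (s≤s (w≤B Fin.zero))) (∈-boundedVecs w (w≤B ∘ Fin.suc))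

module EquationSystem {m : ℕ} (l r : Expr m) where

  L = compile l (suc m)
  R = compile r (next L)

  size : ℕ
  size = next R

  -- The first gate forces the variable 0 to be 1; the last one states l = r as l · 1 = r.
  gateList : List Gate
  gateList = times 0 0 0 ∷ gates L ++ gates R ++ times (output L) 0 (output R) ∷ []

  canonical : Env → Env
  canonical ρ = run r (next L) (run l (suc m) ρ)

  m<next-L : m < next L
  m<next-L = next-mono l (suc m)

  suc-m≤size : suc m ≤ size
  suc-m≤size = ℕ.≤-trans (next-mono l (suc m)) (next-mono r (next L))

  canonical-before : ∀ ρ {j} → j < suc m → canonical ρ j ≡ ρ j
  canonical-before ρ j<suc-m =
    trans (run-before r (next L) _ (ℕ.<-≤-trans j<suc-m (next-mono l (suc m))))
          (run-before l (suc m) ρ j<suc-m)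

  canonical-positive : ∀ ρ → PositiveEnv ρ → PositiveEnv (canonical ρ)
  canonical-positive ρ ρ-pos = run-positive r (next L) _ (run-positive l (suc m) ρ ρ-pos)

  canonical-satisfies : ∀ ρ σ → ρ 0 ≡ 1 → ⟦ l ⟧ (inputs ρ) ≡ ⟦ r ⟧ (inputs ρ) → PositiveEnv σ →
    (∀ j → j < size → σ j ≡ canonical ρ j) → All (σ ⊨_) gateList
  canonical-satisfies ρ σ ρ0≡1 l≡r σ-pos σ≗canonical =
    σ0²≡σ0 ∷ ++⁺ σ⊨L (++⁺ σ⊨R (equation ∷ []))
    where
    σ≗ρ : ∀ j → j < suc m → σ j ≡ ρ j
    σ≗ρ j j<suc-m = trans (σ≗canonical j (ℕ.<-≤-trans j<suc-m suc-m≤size)) (canonical-before ρ j<suc-m)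
    σ0≡1 = trans (σ≗ρ 0 (s≤s z≤n)) ρ0≡1
    σ0²≡σ0 : σ 0 * σ 0 ≡ σ 0
    σ0²≡σ0 rewrite σ0≡1 = refl
    σ⊨L = run-satisfies l (suc m) ρ σ ℕ.≤-refl λ j j<next-L →
      trans (σ≗canonical j (ℕ.<-≤-trans j<next-L (next-mono r (next L)))) (run-before r (next L) _ j<next-L)
    σ⊨R = run-satisfies r (next L) _ σ m<next-L σ≗canonical
    inputs-σ≗ρ : ∀ i → inputs σ i ≡ inputs ρ i
    inputs-σ≗ρ i = σ≗ρ (suc (toℕ i)) (s≤s (Fin.toℕ<n i))
    equation : σ (output L) * σ 0 ≡ σ (output R)
    equation = begin
      σ (output L) * σ 0    ≡⟨ cong (σ (output L) *_) σ0≡1 ⟩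
      σ (output L) * 1      ≡⟨ ℕ.*-identityʳ _ ⟩
      σ (output L)          ≡⟨ output-value l (suc m) σ σ-pos σ0≡1 σ⊨L ⟩
      ⟦ l ⟧ (inputs σ)      ≡⟨ ⟦⟧-cong l inputs-σ≗ρ ⟩
      ⟦ l ⟧ (inputs ρ)      ≡⟨ l≡r ⟩
      ⟦ r ⟧ (inputs ρ)      ≡⟨ ⟦⟧-cong r inputs-σ≗ρ ⟨
      ⟦ r ⟧ (inputs σ)      ≡⟨ output-value r (next L) σ σ-pos σ0≡1 σ⊨R ⟨
      σ (output R)          ∎
      where open ≡-Reasoning

  module Solution (σ : Env) (σ-pos : PositiveEnv σ) (σ⊨ : All (σ ⊨_) gateList) where

    σ⊨L = ++⁻ˡ (gates L) (All.tail σ⊨)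
    σ⊨R = ++⁻ˡ (gates R) (++⁻ʳ (gates L) (All.tail σ⊨))

    σ0≡1 : σ 0 ≡ 1
    σ0≡1 with σ 0 | σ-pos 0 | All.head σ⊨
    ... | suc k | _ | k²≡k = ℕ.*-cancelˡ-≡ (suc k) 1 (suc k) (trans k²≡k (sym (ℕ.*-identityʳ (suc k))))

    satisfies : ⟦ l ⟧ (inputs σ) ≡ ⟦ r ⟧ (inputs σ)
    satisfies with All.head (++⁻ʳ (gates R) (++⁻ʳ (gates L) (All.tail σ⊨)))
    ... | equation = begin
      ⟦ l ⟧ (inputs σ)      ≡⟨ output-value l (suc m) σ σ-pos σ0≡1 σ⊨L ⟨
      σ (output L)          ≡⟨ ℕ.*-identityʳ _ ⟨
      σ (output L) * 1      ≡⟨ cong (σ (output L) *_) σ0≡1 ⟨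
      σ (output L) * σ 0    ≡⟨ equation ⟩
      σ (output R)          ≡⟨ output-value r (next L) σ σ-pos σ0≡1 σ⊨R ⟩
      ⟦ r ⟧ (inputs σ)      ∎
      where open ≡-Reasoning

    canonical-unique : ∀ ρ → (∀ j → j < suc m → σ j ≡ ρ j) → ∀ j → j < size → σ j ≡ canonical ρ j
    canonical-unique ρ σ≗ρ = run-unique r (next L) _ σ m<next-L σ-pos
      (run-unique l (suc m) ρ σ ℕ.≤-refl σ-pos σ≗ρ σ⊨L) σ⊨R

  K : ℕ
  K = pred size

  size≡suc-K : size ≡ suc K
  size≡suc-K = sym (ℕ.suc-pred size {{ℕ.>-nonZero (ℕ.<-≤-trans (s≤s z≤n) suc-m≤size)}})

  system : System (suc K)
  system = map toEqn gateList

  envOf-tabulate : ∀ ρ j → j < size → envOf (tabulate (ρ ∘ toℕ)) j ≡ ρ j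
  envOf-tabulate ρ j j<size =
    trans (Vec.lookup∘tabulate (ρ ∘ toℕ) (toFin j)) (cong ρ (toℕ-toFin (subst (j <_) size≡suc-K j<size)))

  envOf-positive : ∀ (v : Vec ℕ (suc K)) → All (1 ≤_) (toList v) → PositiveEnv (envOf v)
  envOf-positive v v-pos j = AllVec.lookup⁺ (AllVec.toList⁻ v-pos) (toFin j)

  system-complete : ∀ a → (∀ i → 1 ≤ a i) → ⟦ l ⟧ a ≡ ⟦ r ⟧ a →
    Σ (Vec ℕ (suc K)) λ v → PosSolution system v × (∀ i → inputs (envOf v) i ≡ a i)
  system-complete a a-pos l≡r =
    v , (v-pos , ⊨⇒Holds v gateList (canonical-satisfies ρ (envOf v) refl l≡r′ (envOf-positive v v-pos) agree)) ,
    inputs≡a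
    where
    ρ = fromInputs a
    v = tabulate (canonical ρ ∘ toℕ)
    v-pos : All (1 ≤_) (toList v)
    v-pos = AllVec.toList⁺ (AllVec.lookup⁻ λ k →
      subst (1 ≤_) (sym (Vec.lookup∘tabulate (canonical ρ ∘ toℕ) k))
              (canonical-positive ρ (fromInputs-positive a a-pos) (toℕ k)))
    l≡r′ : ⟦ l ⟧ (inputs ρ) ≡ ⟦ r ⟧ (inputs ρ)
    l≡r′ = trans (⟦⟧-cong l (inputs-fromInputs a)) (trans l≡r (sym (⟦⟧-cong r (inputs-fromInputs a))))
    agree = envOf-tabulate (canonical ρ)
    inputs≡a : ∀ i → inputs (envOf v) i ≡ a i
    inputs≡a i = trans (agree _ (ℕ.<-≤-trans (s≤s (Fin.toℕ<n i)) suc-m≤size))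
      (trans (canonical-before ρ (s≤s (Fin.toℕ<n i))) (inputs-fromInputs a i))

  system-sound : ∀ v → PosSolution system v →
    (∀ (i : Fin m) → 1 ≤ inputs (envOf v) i) × ⟦ l ⟧ (inputs (envOf v)) ≡ ⟦ r ⟧ (inputs (envOf v))
  system-sound v (v-pos , holds) =
    (λ i → σ-pos (suc (toℕ i))) , Solution.satisfies (envOf v) σ-pos (Holds⇒⊨ v gateList holds)
    where σ-pos = envOf-positive v v-pos

  system-finite : ∀ B → (∀ v → PosSolution system v → ∀ i → inputs (envOf v) i ≤ B) →
    Finite (PosSolution system)
  system-finite B bounded = map candidate (boundedVecs m B) , λ v sol →
    subst (_∈ map candidate (boundedVecs m B)) (candidate-inputs v sol)
      (∈-map⁺ candidate (∈-boundedVecs (tabulate (inputs (envOf v)))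
        (λ i → subst (_≤ B) (sym (Vec.lookup∘tabulate (inputs (envOf v)) i)) (bounded v sol i))))
    where
    candidate : Vec ℕ m → Vec ℕ (suc K)
    candidate w = tabulate (canonical (fromInputs (lookup w)) ∘ toℕ)
    candidate-inputs : ∀ v → PosSolution system v → candidate (tabulate (inputs (envOf v))) ≡ v
    candidate-inputs v (v-pos , holds) = trans (Vec.tabulate-cong λ k → sym (begin
      lookup v k                               ≡⟨ cong (lookup v) (toFin-toℕ k) ⟨
      envOf v (toℕ k)
        ≡⟨ canonical-unique (fromInputs w)
             (fromInputs-agrees w (envOf v) σ0≡1 (Vec.lookup∘tabulate (inputs (envOf v))))
             (toℕ k) (subst (toℕ k <_) (sym size≡suc-K) (Fin.toℕ<n k)) ⟩
      canonical (fromInputs w) (toℕ k)         ∎)) (Vec.tabulate∘lookup v)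
      where
      open ≡-Reasoning
      open Solution (envOf v) (envOf-positive v v-pos) (Holds⇒⊨ v gateList holds)
      w = lookup (tabulate (inputs (envOf v)))

-- Integers as differences of expressions

ℤExpr : ℕ → Set
ℤExpr m = Expr m × Expr m

⟦_⟧ℤ : ∀ {m} → ℤExpr m → (Fin m → ℕ) → ℤ
⟦ a , b ⟧ℤ x = ⟦ a ⟧ x ⊖ ⟦ b ⟧ x

infixl 6 _⊕ℤ_
infixl 7 _⊗ℤ_

_⊕ℤ_ _⊗ℤ_ : ∀ {m} → ℤExpr m → ℤExpr m → ℤExpr m
(a , b) ⊕ℤ (c , d) = a ⊕ c , b ⊕ d
(a , b) ⊗ℤ (c , d) = a ⊗ c ⊕ b ⊗ d , a ⊗ d ⊕ b ⊗ c

numeral : ∀ {m} → ℕ → Expr m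
numeral zero    = one
numeral (suc k) = numeral k ⊕ one

constℤ : ∀ {m} → ℤ → ℤExpr m
constℤ (+ k)    = numeral k , one
constℤ -[1+ k ] = one , numeral (suc k)

_^ℤ_ : ∀ {m} → ℤExpr m → ℕ → ℤExpr m
x ^ℤ zero  = constℤ (+ 1)
x ^ℤ suc k = x ⊗ℤ x ^ℤ k

⊖≡- : ∀ m n → m ⊖ n ≡ + m ℤ.- + n
⊖≡- m n = sym (ℤ.m-n≡m⊖n m n)

module _ {m : ℕ} (x : Fin m → ℕ) where

  ⟦⊕ℤ⟧ : ∀ a b → ⟦ a ⊕ℤ b ⟧ℤ x ≡ ⟦ a ⟧ℤ x ℤ.+ ⟦ b ⟧ℤ x
  ⟦⊕ℤ⟧ (a , b) (c , d) = begin
    (A + C) ⊖ (B + D)                   ≡⟨ ⊖≡- (A + C) (B + D) ⟩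
    + (A + C) ℤ.- + (B + D)             ≡⟨ cong₂ ℤ._-_ (ℤ.pos-+ A C) (ℤ.pos-+ B D) ⟩
    (+ A ℤ.+ + C) ℤ.- (+ B ℤ.+ + D)         ≡⟨ regroup (+ A) (+ B) (+ C) (+ D) ⟩
    (+ A ℤ.- + B) ℤ.+ (+ C ℤ.- + D)         ≡⟨ cong₂ ℤ._+_ (⊖≡- A B) (⊖≡- C D) ⟨
    (A ⊖ B) ℤ.+ (C ⊖ D)                     ∎
    where
    open ≡-Reasoning
    A = ⟦ a ⟧ x
    B = ⟦ b ⟧ x
    C = ⟦ c ⟧ x
    D = ⟦ d ⟧ x
    regroup : ∀ a b c d → (a ℤ.+ c) ℤ.- (b ℤ.+ d) ≡ (a ℤ.- b) ℤ.+ (c ℤ.- d)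
    regroup = solveℤ-∀

  ⟦⊗ℤ⟧ : ∀ a b → ⟦ a ⊗ℤ b ⟧ℤ x ≡ ⟦ a ⟧ℤ x ℤ.* ⟦ b ⟧ℤ x
  ⟦⊗ℤ⟧ (a , b) (c , d) = begin
    (A * C + B * D) ⊖ (A * D + B * C)
      ≡⟨ ⊖≡- (A * C + B * D) (A * D + B * C) ⟩
    + (A * C + B * D) ℤ.- + (A * D + B * C)
      ≡⟨ cong₂ ℤ._-_ (pos-sum A C B D) (pos-sum A D B C) ⟩
    (+ A ℤ.* + C ℤ.+ + B ℤ.* + D) ℤ.- (+ A ℤ.* + D ℤ.+ + B ℤ.* + C)
      ≡⟨ factor (+ A) (+ B) (+ C) (+ D) ⟩
    (+ A ℤ.- + B) ℤ.* (+ C ℤ.- + D)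
      ≡⟨ cong₂ ℤ._*_ (⊖≡- A B) (⊖≡- C D) ⟨
    (A ⊖ B) ℤ.* (C ⊖ D)
      ∎
    where
    open ≡-Reasoning
    A = ⟦ a ⟧ x
    B = ⟦ b ⟧ x
    C = ⟦ c ⟧ x
    D = ⟦ d ⟧ x
    pos-sum : ∀ a b c d → + (a * b + c * d) ≡ + a ℤ.* + b ℤ.+ + c ℤ.* + d
    pos-sum a b c d = trans (ℤ.pos-+ (a * b) (c * d)) (cong₂ ℤ._+_ (ℤ.pos-* a b) (ℤ.pos-* c d))
    factor : ∀ a b c d → (a ℤ.* c ℤ.+ b ℤ.* d) ℤ.- (a ℤ.* d ℤ.+ b ℤ.* c) ≡ (a ℤ.- b) ℤ.* (c ℤ.- d)
    factor = solveℤ-∀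

  ⟦numeral⟧ : ∀ k → ⟦ numeral k ⟧ x ≡ suc k
  ⟦numeral⟧ zero    = refl
  ⟦numeral⟧ (suc k) = trans (cong (ℕ._+ 1) (⟦numeral⟧ k)) (ℕ.+-comm (suc k) 1)

  ⟦constℤ⟧ : ∀ c → ⟦ constℤ c ⟧ℤ x ≡ c
  ⟦constℤ⟧ (+ k)    = cong (_⊖ 1) (⟦numeral⟧ k)
  ⟦constℤ⟧ -[1+ k ] = cong (1 ⊖_) (⟦numeral⟧ (suc k))

  ⟦^ℤ⟧ : ∀ a k → ⟦ a ^ℤ k ⟧ℤ x ≡ ⟦ a ⟧ℤ x ℤ.^ k
  ⟦^ℤ⟧ a zero    = refl
  ⟦^ℤ⟧ a (suc k) = trans (⟦⊗ℤ⟧ a (a ^ℤ k)) (cong (⟦ a ⟧ℤ x ℤ.*_) (⟦^ℤ⟧ a k))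

module _ {m : ℕ} (E : ℕ) where

  homMonomialₑ : ∀ {k} → (Fin k → ℤExpr m) → (Fin k → ℤExpr m) → Vec ℕ k → ℤExpr m
  homMonomialₑ n d []       = constℤ (+ 1)
  homMonomialₑ n d (e ∷ es) = (n 0F ^ℤ e ⊗ℤ d 0F ^ℤ (E ∸ e)) ⊗ℤ homMonomialₑ (n ∘ Fin.suc) (d ∘ Fin.suc) es

  homogeniseₑ : ∀ {p} → Poly p → (Fin p → ℤExpr m) → (Fin p → ℤExpr m) → ℤExpr m
  homogeniseₑ []            n d = constℤ (+ 0)
  homogeniseₑ ((c , e) ∷ D) n d = constℤ c ⊗ℤ homMonomialₑ n d e ⊕ℤ homogeniseₑ D n d

  module _ (x : Fin m → ℕ) where

    ⟦homMonomialₑ⟧ : ∀ {k} (n d : Fin k → ℤExpr m) e →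
      ⟦ homMonomialₑ n d e ⟧ℤ x ≡ homMonomial E (λ i → ⟦ n i ⟧ℤ x) (λ i → ⟦ d i ⟧ℤ x) e
    ⟦homMonomialₑ⟧ n d []       = refl
    ⟦homMonomialₑ⟧ n d (e ∷ es) = begin
      ⟦ (n 0F ^ℤ e ⊗ℤ d 0F ^ℤ (E ∸ e)) ⊗ℤ rest ⟧ℤ x
        ≡⟨ ⟦⊗ℤ⟧ x (n 0F ^ℤ e ⊗ℤ d 0F ^ℤ (E ∸ e)) rest ⟩
      ⟦ n 0F ^ℤ e ⊗ℤ d 0F ^ℤ (E ∸ e) ⟧ℤ x ℤ.* ⟦ rest ⟧ℤ x
        ≡⟨ cong₂ ℤ._*_
             (trans (⟦⊗ℤ⟧ x (n 0F ^ℤ e) (d 0F ^ℤ (E ∸ e)))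
                    (cong₂ ℤ._*_ (⟦^ℤ⟧ x (n 0F) e) (⟦^ℤ⟧ x (d 0F) (E ∸ e))))
                       (⟦homMonomialₑ⟧ (n ∘ Fin.suc) (d ∘ Fin.suc) es) ⟩
      (⟦ n 0F ⟧ℤ x ℤ.^ e ℤ.* ⟦ d 0F ⟧ℤ x ℤ.^ (E ∸ e)) ℤ.* homMonomial E _ _ es
        ∎
      where
      open ≡-Reasoning
      rest = homMonomialₑ (n ∘ Fin.suc) (d ∘ Fin.suc) es

    ⟦homogeniseₑ⟧ : ∀ {p} (D : Poly p) (n d : Fin p → ℤExpr m) →
      ⟦ homogeniseₑ D n d ⟧ℤ x ≡ homogenise E D (λ i → ⟦ n i ⟧ℤ x) (λ i → ⟦ d i ⟧ℤ x)
    ⟦homogeniseₑ⟧ []            n d = refl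
    ⟦homogeniseₑ⟧ ((c , e) ∷ D) n d =
      trans (⟦⊕ℤ⟧ x (constℤ c ⊗ℤ homMonomialₑ n d e) (homogeniseₑ D n d)) (cong₂ ℤ._+_
        (trans (⟦⊗ℤ⟧ x (constℤ c) (homMonomialₑ n d e)) (cong₂ ℤ._*_ (⟦constℤ⟧ x c) (⟦homMonomialₑ⟧ n d e)))
        (⟦homogeniseₑ⟧ D n d))

⟦⟧ℤ≡0⇒≡ : ∀ {m} (a b : Expr m) x → ⟦ a , b ⟧ℤ x ≡ 0ℤ → ⟦ a ⟧ x ≡ ⟦ b ⟧ x
⟦⟧ℤ≡0⇒≡ a b x eq =
  ℤ.+-injective (ℤ.i-j≡0⇒i≡j (+ ⟦ a ⟧ x) (+ ⟦ b ⟧ x) (trans (sym (⊖≡- (⟦ a ⟧ x) (⟦ b ⟧ x))) eq))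

-- The reduction

codeEquations : ∀ {m} → (Fin 7 → Expr m) → List (Equation m)
codeEquations s =
  (P ⊗ Q ⊕ one , P ⊕ Q) ∷
  (C ⊗ U ⊕ (P ⊕ Q) ⊕ (V ⊕ V) , (P ⊕ Q) ⊗ V ⊕ one ⊕ one ⊕ one) ∷
  (U ⊕ W , P ⊕ Q) ∷
  (V ⊕ W′ , C ⊗ U ⊕ one) ∷ []
  where
  P = s 0F
  Q = s 1F
  C = s 2F
  U = s 3F
  V = s 4F
  W = s 5F
  W′ = s 6F

codeAt : ∀ {m} → (Fin m → ℕ) → (Fin 7 → Fin m) → Code
codeAt a s = code (a (s 0F)) (a (s 1F)) (a (s 2F)) (a (s 3F)) (a (s 4F)) (a (s 5F)) (a (s 6F))

slot-codeAt : ∀ {m} (a : Fin m → ℕ) s o → slot (codeAt a s) o ≡ a (s o)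
slot-codeAt a s 0F = refl
slot-codeAt a s 1F = refl
slot-codeAt a s 2F = refl
slot-codeAt a s 3F = refl
slot-codeAt a s 4F = refl
slot-codeAt a s 5F = refl
slot-codeAt a s 6F = refl

slot-ext : ∀ {c c′} → (∀ o → slot c o ≡ slot c′ o) → c ≡ c′
slot-ext eq with eq 0F | eq 1F | eq 2F | eq 3F | eq 4F | eq 5F | eq 6F
... | refl | refl | refl | refl | refl | refl | refl = refl

Satisfies⇒IsCode : ∀ {m} a (s : Fin 7 → Fin m) → Satisfies (codeEquations (var ∘ s)) a → IsCode (codeAt a s)
Satisfies⇒IsCode a s (e₁ ∷ e₂ ∷ e₃ ∷ e₄ ∷ []) = e₁ , e₂ , e₃ , e₄

IsCode⇒Satisfies : ∀ {m} a (s : Fin 7 → Fin m) → IsCode (codeAt a s) → Satisfies (codeEquations (var ∘ s)) a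
IsCode⇒Satisfies a s (e₁ , e₂ , e₃ , e₄) = e₁ ∷ e₂ ∷ e₃ ∷ e₄ ∷ []

maxOver : ∀ {A : Set} → (A → ℕ) → List A → ℕ
maxOver g xs = max 0 (map g xs)

≤maxOver : ∀ {A : Set} (g : A → ℕ) {x xs} → x ∈ xs → g x ≤ maxOver g xs
≤maxOver g x∈xs = All.lookup (map⁻ (xs≤max 0 (map g _))) x∈xs

module Reduction {p : ℕ} (D : Poly p) where

  m = p * 7
  E = degreeBound D

  slots : Fin p → Fin 7 → Fin m
  slots = combine

  numeratorₑ denominatorₑ : Fin p → ℤExpr m
  numeratorₑ   i = var (slots i 0F) , var (slots i 1F)
  denominatorₑ i = var (slots i 2F) ⊕ one , one

  polynomialEquation : Equation m
  polynomialEquation = homogeniseₑ E D numeratorₑ denominatorₑ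

  equations : List (Equation m)
  equations = polynomialEquation ∷ concat (map (codeEquations ∘ (λ i → var ∘ slots i)) (allFin p))

  open EquationSystem (proj₁ (conjunction equations)) (proj₂ (conjunction equations)) public

  codes : (Fin m → ℕ) → Fin p → Code
  codes a i = codeAt a (slots i)

  ⟦denominatorₑ⟧ : ∀ a i → ⟦ denominatorₑ i ⟧ℤ a ≡ + Code.C (codes a i)
  ⟦denominatorₑ⟧ a i = cong (_⊖ 1) (ℕ.+-comm (a (slots i 2F)) 1)

  homogenise-codes : ∀ a (x : Vec ℚ p) → (∀ i → Represents (codes a i) (lookup x i)) →
    ⟦ polynomialEquation ⟧ℤ a ≡ homogenise E D (↥_ ∘ lookup x) (↧_ ∘ lookup x)
  homogenise-codes a x rep = trans (⟦homogeniseₑ⟧ E a D numeratorₑ denominatorₑ)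
    (homogenise-cong E D (λ i → sym (Represents.numerator (rep i)))
                         (λ i → trans (⟦denominatorₑ⟧ a i) (sym (Represents.denominator (rep i)))))

  record DecodedSolution (a : Fin m → ℕ) : Set where
    field
      solution   : Vec ℚ p
      isSolution : RatSolution D solution
      bounded    : ∀ i o → slot (codes a i) o ≤ codeBound (lookup solution i)

  decodeSolution : ∀ a → (∀ k → 1 ≤ a k) → Satisfies equations a → DecodedSolution a
  decodeSolution a a-pos (poly≡ ∷ ⊨codes) = record { solution = x ; isSolution = x-sol ; bounded = bounded }
    where
    decoded : ∀ i → Decoding (codes a i)
    decoded i = decode (codes a i) (λ o → subst (1 ≤_) (sym (slot-codeAt a (slots i) o)) (a-pos (slots i o)))
      (Satisfies⇒IsCode a (slots i) (tabulate⁻ (map⁻ (concat⁻ ⊨codes)) i))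
    x = tabulate (Decoding.value ∘ decoded)
    x-decoded : ∀ i → lookup x i ≡ Decoding.value (decoded i)
    x-decoded = Vec.lookup∘tabulate (Decoding.value ∘ decoded)
    rep : ∀ i → Represents (codes a i) (lookup x i)
    rep i = subst (Represents (codes a i)) (sym (x-decoded i)) (Decoding.represents (decoded i))
    x-sol : RatSolution D x
    x-sol = homogenise≡0⇒RatSolution D x (trans (sym (homogenise-codes a x rep))
      (trans (cong (_⊖ ⟦ proj₂ polynomialEquation ⟧ a) poly≡) (ℤ.n⊖n≡0 (⟦ proj₂ polynomialEquation ⟧ a))))
    bounded : ∀ i o → slot (codes a i) o ≤ codeBound (lookup x i)
    bounded i o = subst (λ q → slot (codes a i) o ≤ codeBound q) (sym (x-decoded i))
      (Decoding.bounded (decoded i) o)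

  record EncodedSolution (x : Vec ℚ p) : Set where
    field
      assignment : Fin m → ℕ
      positive   : ∀ k → 1 ≤ assignment k
      satisfies  : Satisfies equations assignment
      represents : ∀ i → Represents (codes assignment i) (lookup x i)

  encodeSolution : ∀ (x : Vec ℚ p) → RatSolution D x → EncodedSolution x
  encodeSolution x x-sol = record
    { assignment = a ; positive = a-pos
    ; satisfies = poly≡ ∷ concat⁺ (map⁺ (tabulate⁺ ⊨code)) ; represents = rep }
    where
    enc : ∀ i → Encoding (lookup x i)
    enc i = encode (lookup x i)
    c : Fin p → Code
    c i = Encoding.codeOf (enc i)
    a : Fin m → ℕ
    a k = uncurry (λ i o → slot (c i) o) (remQuot {p} 7 k)
    a-pos : ∀ k → 1 ≤ a k
    a-pos k = Encoding.positive (enc (proj₁ (remQuot {p} 7 k))) (proj₂ (remQuot {p} 7 k))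
    codes≡c : ∀ i → codes a i ≡ c i
    codes≡c i = slot-ext λ o → trans (slot-codeAt a (slots i) o)
      (cong (uncurry (λ i o → slot (c i) o)) (Fin.remQuot-combine i o))
    ⊨code : ∀ i → Satisfies (codeEquations (var ∘ slots i)) a
    ⊨code i = IsCode⇒Satisfies a (slots i) (subst IsCode (sym (codes≡c i)) (Encoding.isCode (enc i)))
    rep : ∀ i → Represents (codes a i) (lookup x i)
    rep i = subst (λ c′ → Represents c′ (lookup x i)) (sym (codes≡c i)) (Encoding.represents (enc i))
    poly≡ : ⟦ proj₁ polynomialEquation ⟧ a ≡ ⟦ proj₂ polynomialEquation ⟧ a
    poly≡ = ⟦⟧ℤ≡0⇒≡ (proj₁ polynomialEquation) (proj₂ polynomialEquation) a
      (trans (homogenise-codes a x rep) (RatSolution⇒homogenise≡0 D x x-sol))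

  solutionsBound : List (Vec ℚ p) → ℕ
  solutionsBound = maxOver (maxOver codeBound ∘ toList)

  codeBound≤solutionsBound : ∀ {x xs} → x ∈ xs → ∀ i → codeBound (lookup x i) ≤ solutionsBound xs
  codeBound≤solutionsBound {x} x∈xs i = ℕ.≤-trans (≤maxOver codeBound (∈-toList⁺ (∈-lookup i x)))
    (≤maxOver (maxOver codeBound ∘ toList) x∈xs)

  inputs≤ : ∀ a {B} → (∀ i o → slot (codes a i) o ≤ B) → ∀ k → a k ≤ B
  inputs≤ a {B} slot≤B k = subst (λ k′ → a k′ ≤ B) (Fin.combine-remQuot {p} 7 k)
    (subst (_≤ B) (slot-codeAt a (slots i) o) (slot≤B i o))
    where
    i = proj₁ (remQuot {p} 7 k)
    o = proj₂ (remQuot {p} 7 k)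

  system-inputs-bounded : ∀ xs → (∀ x → RatSolution D x → x ∈ xs) →
    ∀ v → PosSolution system v → ∀ k → inputs (envOf v) k ≤ solutionsBound xs
  system-inputs-bounded xs complete v v-sol = inputs≤ a λ i o →
    ℕ.≤-trans (bounded i o) (codeBound≤solutionsBound (complete solution isSolution) i)
    where
    a = inputs (envOf v)
    sound = system-sound v v-sol
    open DecodedSolution (decodeSolution a (proj₁ sound) (conjunction-complete a equations (proj₂ sound)))

  height≤f : Conjecture → Finite (RatSolution D) →
    ∀ x → RatSolution D x → ∀ i → height (lookup x i) ≤ f (suc K)
  height≤f conjecture (xs , complete) x x-sol i =
    height≤ (represents i) (slot≤f 0F) (slot≤f 1F) (slot≤f 2F)
    where
    open EncodedSolution (encodeSolution x x-sol)
    completed = system-complete assignment positive (conjunction-sound assignment equations satisfies)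
    v = proj₁ completed
    v≤f : All (_≤ f (suc K)) (toList v)
    v≤f = conjecture (suc K) (s≤s z≤n) system
            (system-finite (solutionsBound xs) (system-inputs-bounded xs complete))
            v (proj₁ (proj₂ completed))
    slot≤f : ∀ o → slot (codes assignment i) o ≤ f (suc K)
    slot≤f o = subst (_≤ f (suc K))
      (trans (proj₂ (proj₂ completed) (slots i o)) (sym (slot-codeAt assignment (slots i) o)))
      (AllVec.lookup⁺ (AllVec.toList⁻ v≤f) (toFin (suc (toℕ (slots i o)))))

theorem4 : Conjecture →
    Σ ((p : ℕ) → Poly p → ℤ) (λ alg →
    (p : ℕ) (D : Poly p) → Finite (RatSolution D) →
    (x : Vec ℚ p) → RatSolution D x →
    All (λ q → + height q ℤ.≤ alg p D) (toList x))
theorem4 conjecture = (λ p D → + f (suc (Reduction.K D))) , λ p D finite x x-sol →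
  AllVec.toList⁺ (AllVec.lookup⁻ λ i → ℤ.+≤+ (Reduction.height≤f D conjecture finite x x-sol i))
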